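{- Let $n\ge 2$ and $M\in\mathcal{M}_n$. If $n$ is odd, then the number of centered flips applicable to $M$ equals the number of visible edges of $M$. If $n$ is even, then the number of centered flips applicable to $M$ is at most the number of visible edges of $M$ and at least half the number of visible edges of $M$, and both of these bounds are tight (there are matchings attaining the upper bound with equality, and matchings attaining the lower bound with equality).
   Context: Fix an integer $n\ge 2$ and place $2n$ points equidistantly on the unit circle. $\mathcal{M}_n$ is the set of all non-crossing straight-line perfect matchings on these $2n$ points (each has $n$ edges). For $M\in\mathcal{M}_n$, two edges $e,f\in M$ span an empty quadrilateral if the convex hull of $e$ and $f$ contains no other edge of $M$; replacing $e,f$ by the other two edges of this quadrilateral yields another matching of $\mathcal{M}_n$, and this operation is called a flip. A flip is centered if the closed quadrilateral contains the center of the circle (the center may lie on its boundary). An edge $e\in M$ is visible if the two rays from the circle center to the endpoints of $e$ cross no other edge of $M$; if $n$ is odd and $M$ has an edge passing through the center, this edge is ignored when deciding visibility of the other edges, and the edge through the center is itself declared not visible.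
   Formalization: Tightness of the upper bound is stated for every even n ≥ 6, since for n = 2 and n = 4 no matching has as many centered flips as visible edges; tightness of the lower bound is stated for every even n ≥ 2. -}

module Defs where

open import Data.Nat using (ℕ; _+_; _*_; _∸_; _<ᵇ_; _≤ᵇ_; _≡ᵇ_)
open import Data.Bool using (Bool; true; false; if_then_else_; _∧_; _∨_; not; _xor_; T)
open import Data.Fin using (Fin; toℕ)
open import Data.List using (List; []; _∷_; length; filterᵇ; allFin; map)
open import Data.Bool.ListAction using (all; any)
open import Data.Nat.ListAction using (sum)
open import Data.Product using (∃)
open import Relation.Binary.PropositionalEquality using (_≡_; _≢_)

Even : ℕ → Set
Even n = ∃ λ k → n ≡ 2 * k

Odd : ℕ → Set
Odd n = ∃ λ k → n ≡ 1 + 2 * k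

-- The 2n points p_0, …, p_{2n-1} on the unit circle, p_i at angle π i / n
-- (counter-clockwise).  A point is represented by its index i.
-- Everything below is stated for a fixed n, with N = 2 * n points.

-- number of steps (of angle π/n) going counter-clockwise from x to y,
-- for x y < N; lies in [0, N).
dist : (N x y : ℕ) → ℕ
dist N x y = if x ≤ᵇ y then y ∸ x else (N ∸ x) + y

inArc : (N x y z : ℕ) → Bool
inArc N x y z = (0 <ᵇ dist N x z) ∧ (dist N x z <ᵇ dist N x y)

module _ (n : ℕ) where

  Pt : Set
  Pt = Fin (2 * n)

  arc : Pt → Pt → Pt → Bool
  arc x y z = inArc (2 * n) (toℕ x) (toℕ y) (toℕ z)

  d : Pt → Pt → ℕ
  d x y = dist (2 * n) (toℕ x) (toℕ y)

-- Non-crossing perfect matchings on the 2n points.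
-- A perfect matching is a fixed-point-free involution `mate`; the edge
-- at i is the segment p_i p_{mate i}.  Two chords with four distinct
-- endpoints on a circle cross iff exactly one endpoint of the second lies
-- strictly inside the arc cut off by the first; non-crossing means that
-- for distinct edges both or neither endpoint of {j, mate j} lie in the
-- arc from i to mate i.

record Matching (n : ℕ) : Set where
  field
    mate        : Pt n → Pt n
    involutive  : ∀ i → mate (mate i) ≡ i
    fixfree     : ∀ i → mate i ≢ i
    noncrossing : ∀ i j → j ≢ i → j ≢ mate i →
                  arc n i (mate i) j ≡ arc n i (mate i) (mate j)

module _ {n : ℕ} (M : Matching n) where
  open Matching M

  -- each edge {i, mate i} is represented once, by its smaller endpoint
  isRep : Pt n → Bool
  isRep i = toℕ i <ᵇ toℕ (mate i)

  -- the edges represented by i and k are different edges (both reps)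
  differ : Pt n → Pt n → Bool
  differ i k = not (toℕ i ≡ᵇ toℕ k)

  points : List (Pt n)
  points = allFin (2 * n)

  isDiameter : Pt n → Bool
  isDiameter g = d n g (mate g) ≡ᵇ n

  -- for a non-diameter edge g, the ray from the centre to p_z crosses g
  -- iff p_z lies strictly inside the shorter arc cut off by g
  -- (the centre lies on the side of the longer arc).
  inShortArc : Pt n → Pt n → Bool
  inShortArc g z =
    if d n g (mate g) <ᵇ n then arc n g (mate g) z else arc n (mate g) g z

  -- the edge at g blocks the ray from the centre to p_z; an edge through
  -- the centre (possible only for n odd) is ignored
  blocksRay : Pt n → Pt n → Bool
  blocksRay g z = not (isDiameter g) ∧ inShortArc g z

  visible : Pt n → Bool
  visible i =
    isRep i ∧ not (isDiameter i) ∧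
    all (λ g → not (isRep g ∧ differ g i) ∨
               not (blocksRay g i ∨ blocksRay g (mate i))) points

  numVisible : ℕ
  numVisible = length (filterᵇ visible points)

  -- the edges at i and j span an empty quadrilateral: no other edge g
  -- meets the interior of the convex hull of the two edges, i.e. no other
  -- edge separates the edge at i from the edge at j (p_i and p_j lie on
  -- the same side of the chord g).
  emptyQuad : Pt n → Pt n → Bool
  emptyQuad i j =
    all (λ g → not (isRep g ∧ differ g i ∧ differ g j) ∨
               not (arc n g (mate g) i xor arc n g (mate g) j)) points

  -- the closed quadrilateral with vertices p_i, p_{mate i}, p_j, p_{mate j}
  -- contains the centre iff no open half-circle contains all four
  -- vertices, i.e. for every vertex x some vertex y is at least a half turn
  -- (n steps) counter-clockwise from x.
  centered : Pt n → Pt n → Bool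
  centered i j =
    all (λ x → any (λ y → n ≤ᵇ d n x y) quad) quad
    where
      quad : List (Pt n)
      quad = i ∷ mate i ∷ j ∷ mate j ∷ []

  centeredFlip : Pt n → Pt n → Bool
  centeredFlip i j =
    isRep i ∧ isRep j ∧ (toℕ i <ᵇ toℕ j) ∧ emptyQuad i j ∧ centered i j

  numCenteredFlips : ℕ
  numCenteredFlips =
    sum (map (λ i → length (filterᵇ (centeredFlip i) points)) points)

{-# OPTIONS --safe #-}
-- Call the endpoint from which a non-diameter edge runs counter-clockwise along its shorter arc
-- the start of the edge.  The visible edges are those whose short arc lies in no other short arc.
--
-- If no edge is a diameter, every point lies in the closed short arc of exactly one visible edge.
-- Let h e be the visible edge whose short arc contains the antipode of the start of e.  The
-- centered flips are exactly the pairs {e, h e}, so they are the edges of the functional graph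
-- of h on the visible edges, and two edges e give the same pair only along a 2-cycle of h.  This
-- gives both bounds.  A 2-cycle forces the two starts to be antipodal; then the n points between
-- them are matched among themselves, so n is even.  Hence h has no 2-cycles for odd n.
--
-- If δ is a diameter, n is odd and the centered flips are exactly the pairs {e, δ} with e visible.
--
-- Tightness: matchings made of nested blocks of consecutive points, whose visible edges are the
-- outer edges of the blocks.  Two blocks of n points give two visible edges and one flip; blocks
-- of 4, n-2 and n-2 points have no antipodal starts once n ≥ 6.
module Submission where

open import Defs
open import Data.Bool using (Bool; true; false; T; not; _∧_; _∨_; _xor_; if_then_else_)
open import Data.Bool.ListAction using (any)
open import Data.Bool.Properties using (T?; T-∧; T-∨)
open import Data.Empty using (⊥; ⊥-elim)
open import Data.Fin using (Fin; toℕ; fromℕ<)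
import Data.Fin as Fin
open import Data.Fin.Properties using (toℕ<n; toℕ-fromℕ<; toℕ-injective; any?)
open import Data.List using (List; []; _∷_; length; filterᵇ; allFin; map; _++_; cartesianProduct)
open import Data.List.Membership.Propositional using (_∈_; find; lose)
open import Data.List.Membership.Propositional.Properties using (∈-∃++; ∈-++⁺ˡ; ∈-++⁺ʳ; ∈-++⁻; ∈-map⁺; ∈-map⁻; ∈-filter⁺; ∈-filter⁻; ∈-allFin; ∈-cartesianProduct⁺)
open import Data.List.Properties using (length-++; length-map; filter-++)
open import Data.List.Relation.Binary.Subset.Propositional using (_⊆_)
import Data.List.Relation.Unary.All as All
import Data.List.Relation.Unary.All.Properties as All
open import Data.List.Relation.Unary.AllPairs using ([]; _∷_)
open import Data.List.Relation.Unary.Any using (here; there)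
import Data.List.Relation.Unary.Any.Properties as Any
open import Data.List.Relation.Unary.Unique.Propositional using (Unique)
import Data.List.Relation.Unary.Unique.Propositional.Properties as Unique
open import Data.Nat
open import Data.Nat.Induction using (<-rec)
open import Data.Nat.ListAction using (sum)
open import Data.Nat.Properties
open import Data.Nat.Tactic.RingSolver using (solve-∀)
open import Data.Product using (_×_; _,_; proj₁; proj₂; swap; ∃; ∃₂)
open import Data.Sum using (_⊎_; inj₁; inj₂; [_,_]′)
import Data.Sum as Sum
open import Data.Unit using (tt)
open import Function using (_∘_; Equivalence)
open import Relation.Binary.Definitions using (tri<; tri≈; tri>)
open import Relation.Binary.PropositionalEquality
open import Relation.Nullary using (¬_; yes; no; Dec)
open import Relation.Nullary.Decidable using (_×-dec_)
open import Algebra.Properties.CommutativeSemigroup +-commutativeSemigroup using (x∙yz≈y∙xz)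

-- Counting with duplicate-free lists.

Unique-⊆⇒length≤ : ∀ {A : Set} {xs ys : List A} → Unique xs → xs ⊆ ys → length xs ≤ length ys
Unique-⊆⇒length≤ {xs = []} [] _ = z≤n
-- One occurrence of `x` is cut out of `ys`; since `x` does not recur in `xs`, the tail still embeds
-- in what remains.
Unique-⊆⇒length≤ {xs = x ∷ xs} (x∉xs ∷ uxs) sub with ∈-∃++ (sub (here refl))
... | us , vs , refl = begin
  suc (length xs)                  ≤⟨ s≤s (Unique-⊆⇒length≤ uxs sub′) ⟩
  suc (length (us ++ vs))          ≡⟨ cong suc (length-++ us) ⟩
  suc (length us + length vs)      ≡⟨ sym (+-suc (length us) (length vs)) ⟩
  length us + length (x ∷ vs)      ≡⟨ sym (length-++ us) ⟩
  length (us ++ x ∷ vs)            ∎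
  where
  open ≤-Reasoning
  sub′ : xs ⊆ us ++ vs
  sub′ z∈xs with ∈-++⁻ us (sub (there z∈xs))
  ... | inj₁ z∈us         = ∈-++⁺ˡ z∈us
  ... | inj₂ (here refl)  = ⊥-elim (All.lookup x∉xs z∈xs refl)
  ... | inj₂ (there z∈vs) = ∈-++⁺ʳ us z∈vs

length-filterᵇ-map : ∀ {A B : Set} (p : B → Bool) (f : A → B) xs →
                     length (filterᵇ p (map f xs)) ≡ length (filterᵇ (p ∘ f) xs)
length-filterᵇ-map p f [] = refl
length-filterᵇ-map p f (x ∷ xs) with p (f x)
... | true  = cong suc (length-filterᵇ-map p f xs)
... | false = length-filterᵇ-map p f xs

-- Turns a double count of the form of `numCenteredFlips` into the length of one list of ordered
-- pairs, so that list inclusions can be used.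
length-filterᵇ-cartesianProduct : ∀ {A B : Set} (R : A → B → Bool) xs ys →
  length (filterᵇ (λ (x , y) → R x y) (cartesianProduct xs ys)) ≡
  sum (map (λ x → length (filterᵇ (R x) ys)) xs)
length-filterᵇ-cartesianProduct R [] ys = refl
length-filterᵇ-cartesianProduct R (x ∷ xs) ys = begin
  length (filterᵇ R′ (map (x ,_) ys ++ cartesianProduct xs ys))
    ≡⟨ cong length (filter-++ (T? ∘ R′) (map (x ,_) ys) _) ⟩
  length (filterᵇ R′ (map (x ,_) ys) ++ filterᵇ R′ (cartesianProduct xs ys))
    ≡⟨ length-++ (filterᵇ R′ (map (x ,_) ys)) ⟩
  length (filterᵇ R′ (map (x ,_) ys)) + length (filterᵇ R′ (cartesianProduct xs ys))
    ≡⟨ cong₂ _+_ (length-filterᵇ-map R′ (x ,_) ys) (length-filterᵇ-cartesianProduct R xs ys) ⟩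
  length (filterᵇ (R x) ys) + sum (map (λ x → length (filterᵇ (R x) ys)) xs) ∎
  where
  open ≡-Reasoning
  R′ = λ (x , y) → R x y

-- Edges of the graph of a function `h` on the vertices `V`.

module FunctionalGraph
  {N : ℕ} (V : Fin N → Bool) (R : Fin N → Fin N → Bool) (h : Fin N → Fin N)
  (R⇒<  : ∀ i j → T (R i j) → toℕ i < toℕ j)
  (R⇒h  : ∀ i j → T (R i j) → (T (V i) × h i ≡ j) ⊎ (T (V j) × h j ≡ i))
  (h⇒R  : ∀ i → T (V i) → T (R i (h i)) ⊎ T (R (h i) i))
  where

  private
    pts = allFin N
    Vs = filterᵇ V pts
    Rs = filterᵇ (λ (i , j) → R i j) (cartesianProduct pts pts)

    graph : Fin N → Fin N × Fin N
    graph i = i , h i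

    ∈Rs : ∀ {i j} → T (R i j) → (i , j) ∈ Rs
    ∈Rs r = ∈-filter⁺ _ (∈-cartesianProduct⁺ (∈-allFin _) (∈-allFin _)) r

    Rs∋ : ∀ {i j} → (i , j) ∈ Rs → T (R i j)
    Rs∋ m = proj₂ (∈-filter⁻ _ {xs = cartesianProduct pts pts} m)

    ∈Vs : ∀ {i} → T (V i) → i ∈ Vs
    ∈Vs v = ∈-filter⁺ _ (∈-allFin _) v

    Vs∋ : ∀ {i} → i ∈ Vs → T (V i)
    Vs∋ m = proj₂ (∈-filter⁻ _ {xs = pts} m)

    Vs-unique : Unique Vs
    Vs-unique = Unique.filter⁺ _ (Unique.allFin⁺ N)

    graph-unique : Unique (map graph Vs)
    graph-unique = Unique.map⁺ (cong proj₁) Vs-unique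

    swap-injective : ∀ {p q : Fin N × Fin N} → swap p ≡ swap q → p ≡ q
    swap-injective refl = refl

    Rs-unique : Unique Rs
    Rs-unique = Unique.filter⁺ _ (Unique.cartesianProduct⁺ (Unique.allFin⁺ N) (Unique.allFin⁺ N))

    -- Edges in `R` are oriented by index, arrows `(i , h i)` by `h`; recording both orientations
    -- makes the two comparable.
    both : List (Fin N × Fin N) → List (Fin N × Fin N)
    both ps = ps ++ map swap ps

    length-both : ∀ ps → length (both ps) ≡ 2 * length ps
    length-both ps = begin
      length (both ps)                  ≡⟨ length-++ ps ⟩
      length ps + length (map swap ps)  ≡⟨ cong (length ps +_) (length-map swap ps) ⟩
      length ps + length ps             ≡⟨ cong (length ps +_) (sym (+-identityʳ _)) ⟩
      2 * length ps                     ∎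
      where open ≡-Reasoning

    both-Rs-unique : Unique (both Rs)
    both-Rs-unique = Unique.++⁺ Rs-unique (Unique.map⁺ swap-injective Rs-unique) disjoint
      where
      disjoint : ∀ {p} → p ∈ Rs × p ∈ map swap Rs → ⊥
      disjoint (m , m′) with ∈-map⁻ swap m′
      ... | _ , m″ , refl = <-asym (R⇒< _ _ (Rs∋ m)) (R⇒< _ _ (Rs∋ m″))

    graph⊆both-Rs : map graph Vs ⊆ both Rs
    graph⊆both-Rs m with ∈-map⁻ graph m
    ... | i , i∈V , refl with h⇒R i (Vs∋ i∈V)
    ...   | inj₁ r = ∈-++⁺ˡ (∈Rs r)
    ...   | inj₂ r = ∈-++⁺ʳ Rs (∈-map⁺ swap (∈Rs r))

    swap-both : ∀ ps → map swap (both ps) ⊆ both ps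
    swap-both ps m with ∈-map⁻ swap m
    ... | _ , m′ , refl with ∈-++⁻ ps m′
    ...   | inj₁ m″ = ∈-++⁺ʳ ps (∈-map⁺ swap m″)
    ...   | inj₂ m″ with ∈-map⁻ swap m″
    ...     | _ , m‴ , refl = ∈-++⁺ˡ m‴

    Rs⊆both-graph : Rs ⊆ both (map graph Vs)
    Rs⊆both-graph {i , j} m with R⇒h i j (Rs∋ m)
    ... | inj₁ (v , refl) = ∈-++⁺ˡ (∈-map⁺ graph (∈Vs v))
    ... | inj₂ (v , refl) = ∈-++⁺ʳ (map graph Vs) (∈-map⁺ swap (∈-map⁺ graph (∈Vs v)))

    ++-⊆ : ∀ {A : Set} (us : List A) {vs ws} → us ⊆ ws → vs ⊆ ws → us ++ vs ⊆ ws
    ++-⊆ us s t m with ∈-++⁻ us m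
    ... | inj₁ a = s a
    ... | inj₂ b = t b

    map-swap-⊆ : ∀ {ps qs : List (Fin N × Fin N)} → ps ⊆ qs → map swap ps ⊆ map swap qs
    map-swap-⊆ s m with ∈-map⁻ swap m
    ... | _ , m′ , refl = ∈-map⁺ swap (s m′)

    both-⊆ : ∀ ps qs → ps ⊆ both qs → both ps ⊆ both qs
    both-⊆ ps qs s = ++-⊆ ps s (swap-both qs ∘ map-swap-⊆ s)

  #V #R : ℕ
  #V = length Vs
  #R = sum (map (λ i → length (filterᵇ (R i) pts)) pts)

  private
    #R≡ : length Rs ≡ #R
    #R≡ = length-filterᵇ-cartesianProduct R pts pts

    #both-Rs : length (both Rs) ≡ 2 * #R
    #both-Rs = trans (length-both Rs) (cong (2 *_) #R≡)

    #both-graph : length (both (map graph Vs)) ≡ 2 * #V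
    #both-graph = trans (length-both (map graph Vs)) (cong (2 *_) (length-map graph Vs))

  -- Each edge, in either orientation, is an arrow of `h` or a reversed arrow. The orientations are
  -- `2 * #R` distinct pairs inside a list of `2 * #V` pairs.
  #R≤#V : #R ≤ #V
  #R≤#V = *-cancelˡ-≤ 2 (subst₂ _≤_ #both-Rs #both-graph
    (Unique-⊆⇒length≤ both-Rs-unique (both-⊆ Rs (map graph Vs) Rs⊆both-graph)))

  -- Arrows of `h` have distinct sources, and each is an edge in one of its two orientations.
  #V≤2*#R : #V ≤ 2 * #R
  #V≤2*#R = subst₂ _≤_ (length-map graph Vs) #both-Rs
    (Unique-⊆⇒length≤ graph-unique graph⊆both-Rs)

  -- Without 2-cycles no arrow is the reversal of an arrow, so the `2 * #V` arrows and reversed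
  -- arrows are distinct.
  #R≡#V : (∀ i j → T (V i) → T (V j) → h i ≡ j → h j ≢ i) → #R ≡ #V
  #R≡#V acyclic = ≤-antisym #R≤#V (*-cancelˡ-≤ 2 (subst₂ _≤_ #both-graph #both-Rs
    (Unique-⊆⇒length≤ both-graph-unique (both-⊆ (map graph Vs) Rs graph⊆both-Rs))))
    where
    disjoint : ∀ {p} → p ∈ map graph Vs × p ∈ map swap (map graph Vs) → ⊥
    disjoint (m , m′) with ∈-map⁻ graph m | ∈-map⁻ swap m′
    ... | i , v , refl | _ , m″ , eq with ∈-map⁻ graph m″
    ...   | j , w , refl = acyclic i j (Vs∋ v) (Vs∋ w) (cong proj₂ eq) (sym (cong proj₁ eq))

    both-graph-unique : Unique (both (map graph Vs))
    both-graph-unique = Unique.++⁺ graph-unique (Unique.map⁺ swap-injective graph-unique) disjoint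

  -- If every edge is a 2-cycle, both of its orientations are arrows, whence `2 * #R ≤ #V`.
  #V≡2*#R : (∀ i j → T (R i j) → h i ≡ j × h j ≡ i) →
            (∀ i j → T (R i j) → T (V i) × T (V j)) → #V ≡ 2 * #R
  #V≡2*#R cyclic inV = ≤-antisym #V≤2*#R (subst₂ _≤_ #both-Rs (length-map graph Vs)
    (Unique-⊆⇒length≤ both-Rs-unique (++-⊆ Rs fwd bwd)))
    where
    fwd : Rs ⊆ map graph Vs
    fwd {i , j} m with cyclic i j (Rs∋ m) | inV i j (Rs∋ m)
    ... | refl , _ | v , _ = ∈-map⁺ graph (∈Vs v)

    bwd : map swap Rs ⊆ map graph Vs
    bwd m with ∈-map⁻ swap m
    ... | (i , j) , m′ , refl with cyclic i j (Rs∋ m′) | inV i j (Rs∋ m′)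
    ...   | _ , refl | _ , w = ∈-map⁺ graph (∈Vs w)

-- Counter-clockwise distance modulo `N`.

module _ {N x y : ℕ} where

  dist-≤ : x ≤ y → x + dist N x y ≡ y
  dist-≤ x≤y with x ≤ᵇ y | ≤⇒≤ᵇ x≤y
  ... | true | _ = m+[n∸m]≡n x≤y

  dist-> : x ≤ N → y < x → x + dist N x y ≡ N + y
  dist-> x≤N y<x with x ≤ᵇ y | ≤ᵇ⇒≤ x y
  ... | true  | f = ⊥-elim (<⇒≱ y<x (f tt))
  ... | false | _ = trans (sym (+-assoc x (N ∸ x) y)) (cong (_+ y) (m+[n∸m]≡n x≤N))

-- The graph of `dist` without truncated subtraction: the walk from `x` to `y` either keeps to
-- increasing indices or wraps past 0 once.
Steps : (N x y a : ℕ) → Set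
Steps N x y a = (x ≤ y × x + a ≡ y) ⊎ (y < x × x + a ≡ N + y)

-- Adding the equations determines `a + b` up to one turn. The number of wraps selects the outcome;
-- two combinations contradict the order of the indices.
steps-compose : ∀ {N} x {y z a b c} → Steps N x y a → Steps N y z b → Steps N x z c →
                (a + b ≡ c) ⊎ (a + b ≡ N + c)
steps-compose {N} x {y} {z} {a} {b} {c} = go
  where
  left : ∀ {s t} → x + a ≡ s → s + b ≡ t → x + (a + b) ≡ t
  left p q = trans (sym (+-assoc x a b)) (trans (cong (_+ b) p) q)

  direct : ∀ {t} → x + (a + b) ≡ t → x + c ≡ t → (a + b ≡ c) ⊎ (a + b ≡ N + c)
  direct p q = inj₁ (+-cancelˡ-≡ x _ _ (trans p (sym q)))

  wrapped : ∀ {t} → x + (a + b) ≡ N + t → x + c ≡ t → (a + b ≡ c) ⊎ (a + b ≡ N + c)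
  wrapped p q = inj₂ (+-cancelˡ-≡ x _ _ (trans p (trans (cong (N +_) (sym q)) (x∙yz≈y∙xz N x c))))

  shift : ∀ {t} → y + b ≡ t → N + y + b ≡ N + t
  shift q = trans (+-assoc N y b) (cong (N +_) q)

  go : Steps N x y a → Steps N y z b → Steps N x z c → (a + b ≡ c) ⊎ (a + b ≡ N + c)
  go (inj₁ (_ , e))   (inj₁ (_ , f))   (inj₁ (_ , g))   = direct (left e f) g
  go (inj₁ (x≤y , _)) (inj₁ (y≤z , _)) (inj₂ (z<x , _)) = ⊥-elim (<⇒≱ z<x (≤-trans x≤y y≤z))
  go (inj₁ (_ , e))   (inj₂ (_ , f))   (inj₁ (_ , g))   = wrapped (left e f) g
  go (inj₁ (_ , e))   (inj₂ (_ , f))   (inj₂ (_ , g))   = direct (left e f) g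
  go (inj₂ (_ , e))   (inj₁ (_ , f))   (inj₁ (_ , g))   = wrapped (left e (shift f)) g
  go (inj₂ (_ , e))   (inj₁ (_ , f))   (inj₂ (_ , g))   = direct (left e (shift f)) g
  go (inj₂ (y<x , _)) (inj₂ (z<y , _)) (inj₁ (x≤z , _)) = ⊥-elim (<⇒≱ (<-trans z<y y<x) x≤z)
  go (inj₂ (_ , e))   (inj₂ (_ , f))   (inj₂ (_ , g))   = wrapped (left e (shift f)) g

dist-steps : ∀ {N} x y → x ≤ N → Steps N x y (dist N x y)
dist-steps x y x≤N with x ≤? y
... | yes p = inj₁ (p , dist-≤ p)
... | no ¬p = inj₂ (≰⇒> ¬p , dist-> x≤N (≰⇒> ¬p))

-- The cyclic order of the points.

module Circle (n : ℕ) where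

  N = 2 * n

  N≡n+n : N ≡ n + n
  N≡n+n = cong (n +_) (+-identityʳ n)

  -- d unfolds too eagerly for its arguments to be inferred from its values.
  opaque
    D : Pt n → Pt n → ℕ
    D = d n

    D-steps : (x y : Pt n) → Steps N (toℕ x) (toℕ y) (D x y)
    D-steps x y = dist-steps (toℕ x) (toℕ y) (<⇒≤ (toℕ<n x))

  d<N : (x y : Pt n) → D x y < N
  d<N x y with D-steps x y
  ... | inj₁ (_ , e) = ≤-<-trans (m≤n+m _ (toℕ x)) (subst (_< N) (sym e) (toℕ<n y))
  ... | inj₂ (y<x , e) = +-cancelˡ-< (toℕ x) _ _
        (subst₂ _<_ (sym e) (+-comm N (toℕ x)) (+-monoʳ-< N y<x))

  d-refl : (x : Pt n) → D x x ≡ 0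
  d-refl x with D-steps x x
  ... | inj₁ (_ , e)   = +-cancelˡ-≡ (toℕ x) _ _ (trans e (sym (+-identityʳ _)))
  ... | inj₂ (x<x , _) = ⊥-elim (<-irrefl refl x<x)

  d≡0⇒≡ : {x y : Pt n} → D x y ≡ 0 → x ≡ y
  d≡0⇒≡ {x} {y} dxy≡0 with D-steps x y
  ... | inj₁ (_ , e) = toℕ-injective (trans (sym (+-identityʳ _)) (trans (cong (toℕ x +_) (sym dxy≡0)) e))
  ... | inj₂ (_ , e) = ⊥-elim (<-irrefl
        (trans (sym (+-identityʳ _)) (trans (cong (toℕ x +_) (sym dxy≡0)) e))
        (≤-trans (toℕ<n x) (m≤m+n N (toℕ y))))

  ≢⇒0<d : {x y : Pt n} → x ≢ y → 0 < D x y
  ≢⇒0<d x≢y = n≢0⇒n>0 (x≢y ∘ d≡0⇒≡)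

  d-triangle : (x y z : Pt n) →
    (D x y + D y z ≡ D x z) ⊎ (D x y + D y z ≡ N + D x z)
  d-triangle x y z = steps-compose (toℕ x) (D-steps x y) (D-steps y z) (D-steps x z)

  -- Seen from b, the points appear in the linear order of D b.
  rebase-≤ : ∀ b {y z} → D b y ≤ D b z → D b y + D y z ≡ D b z
  rebase-≤ b {y} {z} le with d-triangle b y z
  ... | inj₁ e = e
  ... | inj₂ e = ⊥-elim (<-irrefl (trans e (+-comm N _)) (+-mono-≤-< le (d<N y z)))

  rebase-> : ∀ b {y z} → D b z < D b y → D b y + D y z ≡ N + D b z
  rebase-> b {y} {z} lt with d-triangle b y z
  ... | inj₁ e = ⊥-elim (<⇒≱ lt (subst (D b y ≤_) e (m≤m+n _ _)))
  ... | inj₂ e = e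

  d+d≡N : {x y : Pt n} → x ≢ y → D x y + D y x ≡ N
  d+d≡N {x} {y} x≢y = trans (rebase-> x (subst (_< D x y) (sym (d-refl x)) (≢⇒0<d x≢y)))
                            (trans (cong (N +_) (d-refl x)) (+-identityʳ N))

  opaque
    unfolding D

    walk : (x : Pt n) (t : ℕ) → t < N → ∃ λ y → D x y ≡ t
    walk x t t<N with toℕ x + t <? N
    ... | yes lt = fromℕ< lt , +-cancelˡ-≡ (toℕ x) _ _
          (trans (cong (λ k → toℕ x + dist N (toℕ x) k) (toℕ-fromℕ< lt)) (dist-≤ (m≤m+n _ t)))
    ... | no ¬lt = fromℕ< z<N , +-cancelˡ-≡ (toℕ x) _ _
          (trans (cong (λ k → toℕ x + dist N (toℕ x) k) (toℕ-fromℕ< z<N))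
          (trans (dist-> (<⇒≤ (toℕ<n x)) z<x)
          (m+[n∸m]≡n (≮⇒≥ ¬lt))))
      where
      z : ℕ
      z = toℕ x + t ∸ N
      z<x : z < toℕ x
      z<x = +-cancelˡ-< N _ _ (subst₂ _<_ (sym (m+[n∸m]≡n (≮⇒≥ ¬lt))) (+-comm (toℕ x) N)
              (+-monoʳ-< (toℕ x) t<N))
      z<N : z < N
      z<N = <-trans z<x (toℕ<n x)

  0<n : Pt n → 0 < n
  0<n x = *-cancelˡ-< 2 0 n (≤-<-trans z≤n (toℕ<n x))

  antipode : (x : Pt n) → ∃ λ y → D x y ≡ n
  antipode x = walk x n (subst (n <_) (sym N≡n+n) (m<m+n n (0<n x)))

  d-injective : ∀ b {y z} → D b y ≡ D b z → y ≡ z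
  d-injective b {y} {z} e = d≡0⇒≡ (+-cancelˡ-≡ (D b y) _ _
    (trans (rebase-≤ b (≤-reflexive e)) (trans (sym e) (sym (+-identityʳ _)))))

  -- If `x` came no later than `y` from `b`, the walk from `x` to `y` would be part of the walk from
  -- `b` to `y`, hence shorter than a half turn.
  far⇒before : ∀ b {x y} → D b y < n → n ≤ D x y → D b y < D b x
  far⇒before b {x} {y} y<n far = ≰⇒> λ le →
    <⇒≱ y<n (≤-trans far (subst (D x y ≤_) (rebase-≤ b le) (m≤n+m _ _)))

-- Short arcs, their nesting, and the cover of the circle by visible edges.

module Geometry {n : ℕ} (M : Matching n) where
  open Matching M
  open Circle n

  ℓ : Pt n → ℕ
  ℓ g = D g (mate g)

  Inside : Pt n → Pt n → Set
  Inside g z = 0 < D g z × D g z < ℓ g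

  -- `Vis` tests only the endpoint `s`: by `inside-mate`, an arc cut off by an edge that contains
  -- one endpoint of an edge contains the other too.
  Start Diam Vis : Pt n → Set
  Start g = ℓ g < n
  Diam g = ℓ g ≡ n
  Vis s = Start s × (∀ g → Start g → ¬ Inside g s)

  -- The arc is closed, so that endpoints count as covered and no point is missed.
  Covers : Pt n → Pt n → Set
  Covers s x = D s x ≤ ℓ s

  OnEdge : Pt n → Pt n → Set
  OnEdge i x = x ≡ i ⊎ x ≡ mate i

  OnQuad : Pt n → Pt n → Pt n → Set
  OnQuad i j x = OnEdge i x ⊎ OnEdge j x

  Empty Centered : Pt n → Pt n → Set
  Empty i j = ∀ g → ¬ OnQuad i j g → (Inside g i → Inside g j) × (Inside g j → Inside g i)
  Centered i j = ∀ x → OnQuad i j x → ∃ λ y → OnQuad i j y × n ≤ D x y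

  mate-swap : ∀ {x y} → x ≡ mate y → y ≡ mate x
  mate-swap {x} {y} e = trans (sym (involutive y)) (cong mate (sym e))

  edge-mate : ∀ {i x} → OnEdge i x → OnEdge i (mate x)
  edge-mate (inj₁ refl) = inj₂ refl
  edge-mate (inj₂ refl) = inj₁ (involutive _)

  edge-sym : ∀ {i x} → OnEdge i x → OnEdge x i
  edge-sym (inj₁ e) = inj₁ (sym e)
  edge-sym (inj₂ e) = inj₂ (mate-swap e)

  edge-trans : ∀ {i x y} → OnEdge i x → OnEdge x y → OnEdge i y
  edge-trans p (inj₁ refl) = p
  edge-trans p (inj₂ refl) = edge-mate p

  edge? : ∀ i x → Dec (OnEdge i x)
  edge? i x with x Fin.≟ i | x Fin.≟ mate i
  ... | yes e | _ = yes (inj₁ e)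
  ... | no _ | yes e = yes (inj₂ e)
  ... | no a | no b = no [ a , b ]′

  opaque
    unfolding D

    inside⇒arc : ∀ {g z} → Inside g z → T (arc n g (mate g) z)
    inside⇒arc (p , q) = Equivalence.from T-∧ (<⇒<ᵇ p , <⇒<ᵇ q)

    arc⇒inside : ∀ {g z} → T (arc n g (mate g) z) → Inside g z
    arc⇒inside t with Equivalence.to T-∧ t
    ... | p , q = <ᵇ⇒< _ _ p , <ᵇ⇒< _ _ q

  inside-off : ∀ {g z} → Inside g z → ¬ OnEdge g z
  inside-off {g} (p , _) (inj₁ refl) = <-irrefl (sym (d-refl g)) p
  inside-off (_ , q) (inj₂ refl) = <-irrefl refl q

  inside-mate : ∀ {g z} → Inside g z → Inside g (mate z)
  inside-mate {g} {z} p = arc⇒inside (subst T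
    (noncrossing g z (inside-off p ∘ inj₁) (inside-off p ∘ inj₂)) (inside⇒arc p))

  inside-edge : ∀ {g i x} → OnEdge i x → Inside g i → Inside g x
  inside-edge (inj₁ refl) p = p
  inside-edge (inj₂ refl) p = inside-mate p

  inside? : ∀ g z → Dec (Inside g z)
  inside? g z = (0 <? D g z) ×-dec (D g z <? ℓ g)

  ℓ-mate : ∀ g → ℓ (mate g) ≡ D (mate g) g
  ℓ-mate g = cong (D (mate g)) (involutive g)

  ℓ+ℓ-mate : ∀ g → ℓ g + ℓ (mate g) ≡ N
  ℓ+ℓ-mate g = trans (cong (ℓ g +_) (ℓ-mate g)) (d+d≡N (λ e → fixfree g (sym e)))

  mate-far : ∀ {s} → Start s → n < ℓ (mate s)
  mate-far {s} st = +-cancelˡ-< n _ _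
    (≤-<-trans (≤-reflexive (trans (sym N≡n+n) (sym (ℓ+ℓ-mate s)))) (+-monoˡ-< _ st))

  diam-mate : ∀ {g} → Diam g → Diam (mate g)
  diam-mate {g} e = +-cancelˡ-≡ n _ _ (trans (cong (_+ ℓ (mate g)) (sym e)) (trans (ℓ+ℓ-mate g) N≡n+n))

  start-mate : ∀ {s} → Start s → ¬ Start (mate s)
  start-mate st = <-asym (mate-far st)

  ¬start×diam : ∀ {s g} → Start s → Diam g → ¬ OnEdge g s
  ¬start×diam st e (inj₁ refl) = <-irrefl e st
  ¬start×diam st e (inj₂ refl) = <-irrefl (diam-mate e) st

  start-unique : ∀ {s t} → Start s → Start t → OnEdge s t → s ≡ t
  start-unique st st′ (inj₁ e) = sym e
  start-unique st st′ (inj₂ refl) = ⊥-elim (start-mate st st′)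

  trichotomy : ∀ g → Start g ⊎ Diam g ⊎ Start (mate g)
  trichotomy g with <-cmp (ℓ g) n
  ... | tri< p _ _ = inj₁ p
  ... | tri≈ _ p _ = inj₂ (inj₁ p)
  ... | tri> _ _ p = inj₂ (inj₂ (+-cancelˡ-< n _ _ (<-≤-trans (+-monoˡ-< _ p)
          (≤-reflexive (trans (ℓ+ℓ-mate g) N≡n+n)))))

  -- The open arcs of `g` and `mate g` are the two sides of one edge.
  outside⇒inside-mate : ∀ {g z} → ¬ OnEdge g z → ¬ Inside g z → Inside (mate g) z
  outside⇒inside-mate {g} {z} off out = ≢⇒0<d (λ e → off (inj₂ (sym e))) ,
    +-cancelˡ-< (ℓ g) _ _ (subst₂ _<_ (sym (rebase-≤ g le)) (sym (ℓ+ℓ-mate g)) (d<N g z))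
    where
    le : ℓ g ≤ D g z
    le = ≮⇒≥ (λ lt → out (≢⇒0<d (λ e → off (inj₁ (sym e))) , lt))

  ¬inside-both : ∀ {g z} → Inside g z → ¬ Inside (mate g) z
  ¬inside-both {g} {z} (p , q) (_ , r) = <⇒≱ (+-monoʳ-< (ℓ g) r)
    (≤-trans (≤-reflexive (ℓ+ℓ-mate g)) (≤-trans (m≤m+n N _) (≤-reflexive (sym (rebase-> g q)))))

  -- If `mate s` came first, the arc from `mate s` to `s`, longer than a half turn, would fit inside
  -- the short arc of `g`.
  inside-order : ∀ {g s} → Start g → Start s → Inside g s → D g s < D g (mate s)
  inside-order {g} {s} stg sts (_ , q) = ≰⇒> λ le → <-asym (<-trans q stg)
    (<-≤-trans (mate-far sts) (≤-trans (≤-reflexive (ℓ-mate s))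
      (subst (D (mate s) s ≤_) (rebase-≤ g le) (m≤n+m _ _))))

  -- The ends of a diameter are a half turn apart in both directions, too far for both to lie
  -- strictly inside an arc of at most `n` steps.
  ¬inside-diam : ∀ {e g} → ℓ e ≤ n → Diam g → ¬ Inside e g
  ¬inside-diam {e} {g} le dg p@(_ , q) with inside-mate p
  ... | (_ , q′) with D e g ≤? D e (mate g)
  ...   | yes x = <⇒≱ (<-≤-trans q′ le) (subst₂ _≤_ dg (rebase-≤ e x) (m≤n+m _ _))
  ...   | no x = <⇒≱ (<-≤-trans q le) (+-cancelʳ-≤ n n _ (begin
          n + n ≡⟨ sym N≡n+n ⟩
          N ≤⟨ m≤m+n N _ ⟩
          N + D e (mate g) ≡⟨ sym (rebase-> e (≰⇒> x)) ⟩
          D e g + ℓ g ≡⟨ cong (D e g +_) dg ⟩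
          D e g + n ∎))
    where open ≤-Reasoning

  -- Were `t` before `mate s`, it would lie inside the arc of `s`; were `mate t` before `t`, the
  -- short arc of `t` would wrap around and contain `s`.
  separate : ∀ {s t} → Vis s → Vis t → s ≢ t → ℓ s < D s t × D s t < D s (mate t)
  separate {s} {t} (sts , vs) (stt , vt) s≢t = first , second
    where
    off : ¬ OnEdge s t
    off on = s≢t (start-unique sts stt on)
    first : ℓ s < D s t
    first = ≤∧≢⇒< (≮⇒≥ λ lt → vt s sts (≢⇒0<d s≢t , lt))
                  (λ e → off (inj₂ (sym (d-injective s e))))
    second : D s t < D s (mate t)
    second = ≰⇒> λ le → let
        0<q : 0 < D s (mate t)
        0<q = ≢⇒0<d (λ e → off (inj₂ (mate-swap e)))
        lt : D s (mate t) < D s t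
        lt = ≤∧≢⇒< le (λ e → fixfree t (d-injective s e))
        s<t : D s s < D s t
        s<t = subst (_< D s t) (sym (d-refl s)) (≢⇒0<d s≢t)
      in vs t stt (≢⇒0<d (s≢t ∘ sym) , +-cancelˡ-< (D s t) _ _
        (subst₂ _<_ (sym (rebase-> s s<t)) (sym (rebase-> s lt))
          (+-monoʳ-< N (subst (_< D s (mate t)) (sym (d-refl s)) 0<q))))

  -- As `t` precedes `mate t` seen from `b`, the arc of `t` does not wrap past `b` and is an
  -- interval in the linear order from `b`.
  covers⇒between : ∀ {b t x} → D b t < D b (mate t) → Covers t x →
                   D b t ≤ D b x × D b x ≤ D b (mate t)
  covers⇒between {b} {t} {x} lt c with D b t ≤? D b x
  ... | yes le = le , subst₂ _≤_ (rebase-≤ b le) (rebase-≤ b (<⇒≤ lt)) (+-monoʳ-≤ (D b t) c)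
  ... | no ¬le = ⊥-elim (<⇒≱ (d<N b (mate t)) (≤-trans (m≤m+n N _)
          (subst₂ _≤_ (rebase-> b (≰⇒> ¬le)) (rebase-≤ b (<⇒≤ lt)) (+-monoʳ-≤ (D b t) c))))

  between⇒covers : ∀ {b t x} → D b t ≤ D b x → D b x ≤ D b (mate t) → Covers t x
  between⇒covers {b} {t} {x} p q = +-cancelˡ-≤ (D b t) _ _
    (subst₂ _≤_ (sym (rebase-≤ b p)) (sym (rebase-≤ b (≤-trans p q))) q)

  cover-unique : ∀ {s t x} → Vis s → Vis t → Covers s x → Covers t x → s ≡ t
  cover-unique {s} {t} vs vt cs ct with s Fin.≟ t
  ... | yes e = e
  ... | no s≢t with separate vs vt s≢t
  ...   | p , q = ⊥-elim (<⇒≱ p (≤-trans (proj₁ (covers⇒between q ct)) cs))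

  -- Seen from `g`, the arc of `s` is an interval ending at `mate s`, which is still strictly inside
  -- the arc of `g`.
  enclose : ∀ {g s x} → Start g → Start s → Inside g s → Covers s x → Covers g x × ℓ s < ℓ g
  enclose {g} {s} stg sts ins c =
    <⇒≤ (≤-<-trans (proj₂ (covers⇒between lt c)) (proj₂ (inside-mate ins))) ,
    ≤-<-trans (subst (ℓ s ≤_) (rebase-≤ g (<⇒≤ lt)) (m≤n+m _ _)) (proj₂ (inside-mate ins))
    where lt = inside-order stg sts ins

  private
    -- Passes to enclosing short arcs until none exists. Lengths increase strictly and stay below
    -- `n`, so `k` with `n ≤ k + ℓ s` is enough fuel.
    grow : ∀ k {s x} → Start s → Covers s x → n ≤ k + ℓ s → ∃ λ t → Vis t × Covers t x
    grow zero st c le = ⊥-elim (<⇒≱ st le)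
    grow (suc k) {s} st c le with any? (λ g → (ℓ g <? n) ×-dec inside? g s)
    ... | no none = s , (st , λ g stg ins → none (g , stg , ins)) , c
    ... | yes (g , stg , ins) = let c′ , lt = enclose stg st ins c in
          grow k stg c′ (≤-trans le (subst (_≤ k + ℓ g) (+-suc k (ℓ s)) (+-monoʳ-≤ k lt)))

  cover : (∀ g → ¬ Diam g) → ∀ x → ∃ λ t → Vis t × Covers t x
  cover ¬diam x with trichotomy x
  -- The search starts from the short arc of the edge at `x`, of which `x` is an endpoint.
  ... | inj₁ st = grow n st (subst (_≤ ℓ x) (sym (d-refl x)) z≤n) (m≤m+n n _)
  ... | inj₂ (inj₁ e) = ⊥-elim (¬diam x e)
  ... | inj₂ (inj₂ st) = grow n st (≤-reflexive (sym (ℓ-mate x))) (m≤m+n n _)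

  -- Constraints on the vertices of a centered flip.

  module _ {i j : Pt n} (cen : Centered i j) where
    -- Infinite descent: within an open half turn from `g`, a vertex at least a half turn ahead of
    -- `x` comes earlier than `x` in the order from `g`.
    centered⇒¬window : ∀ g → ¬ (∀ x → OnQuad i j x → D g x < n)
    centered⇒¬window g win = descend n (inj₁ (inj₁ refl)) (win i (inj₁ (inj₁ refl)))
      where
      descend : ∀ k {x} → OnQuad i j x → ¬ (D g x < k)
      descend (suc k) {x} q lt with cen x q
      ... | y , q′ , far = descend k q′ (<-≤-trans (far⇒before g (win y q′) far) (s≤s⁻¹ lt))

    -- If `i` were inside the short arc of `g`, emptiness would put the other edge inside it too,
    -- unless that edge is the one at `g`. Either way all four vertices fit in less than a half turn
    -- from `g`.
    flip⇒¬inside : Empty i j → ∀ g → Start g → ¬ Inside g i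
    flip⇒¬inside emp g st ins = centered⇒¬window g win
      where
      on : ∀ {e x} → OnEdge g e → OnEdge e x → D g x < n
      on p q with edge-trans p q
      ... | inj₁ refl = ≤-<-trans (subst (_≤ ℓ g) (sym (d-refl g)) z≤n) st
      ... | inj₂ refl = st
      win : ∀ x → OnQuad i j x → D g x < n
      win x (inj₁ p) = <-trans (proj₂ (inside-edge p ins)) st
      win x (inj₂ p) with edge? j g
      ... | yes q = on (edge-sym q) p
      ... | no ¬q = <-trans (proj₂ (inside-edge p (proj₁ (emp g
            [ (λ r → inside-off ins (edge-sym r)) , ¬q ]′) ins))) st

    -- Seen from `i` the vertices are at 0, `l`, `a`, `b`, in this order. Centeredness at `i` gives
    -- `n ≤ b`, at `j` it gives `a ≤ n + l`. If `a ≤ n`, the antipode of `i` falls between `a` and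
    -- `b`; otherwise the antipode of `j` falls at `a - n`, which is at most `l`.
    flip⇒adjacent : Vis i → Vis j → i ≢ j → ∀ {i′ j′} → D i i′ ≡ n → D j j′ ≡ n →
                    Covers j i′ ⊎ Covers i j′
    flip⇒adjacent vi vj i≢j {i′} {j′} ei ej = result
      where
      l = ℓ i ; a = D i j ; b = D i (mate j)
      sep = separate vi vj i≢j
      n≤b : n ≤ b
      n≤b with cen i (inj₁ (inj₁ refl))
      ... | y , inj₁ (inj₁ refl) , far = ≤-trans far (≤-trans (≤-reflexive (d-refl i)) z≤n)
      ... | y , inj₁ (inj₂ refl) , far = ⊥-elim (<⇒≱ (proj₁ vi) far)
      ... | y , inj₂ (inj₁ refl) , far = ≤-trans far (<⇒≤ (proj₂ sep))
      ... | y , inj₂ (inj₂ refl) , far = far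
      bound : ∀ {y} → D i y ≤ l → n ≤ D j y → a ≤ n + l
      bound {y} le far = +-cancelʳ-≤ n _ _ (begin
        a + n ≤⟨ +-monoʳ-≤ a far ⟩
        a + D j y ≡⟨ rebase-> i (≤-<-trans le (proj₁ sep)) ⟩
        N + D i y ≤⟨ +-monoʳ-≤ N le ⟩
        N + l ≡⟨ cong (_+ l) N≡n+n ⟩
        n + n + l ≡⟨ +-assoc n n l ⟩
        n + (n + l) ≡⟨ +-comm n (n + l) ⟩
        n + l + n ∎)
        where open ≤-Reasoning
      a≤n+l : a ≤ n + l
      a≤n+l with cen j (inj₂ (inj₁ refl))
      ... | y , inj₁ (inj₁ refl) , far = bound (≤-trans (≤-reflexive (d-refl i)) z≤n) far
      ... | y , inj₁ (inj₂ refl) , far = bound ≤-refl far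
      ... | y , inj₂ (inj₁ refl) , far = ⊥-elim (<⇒≱ (0<n i) (≤-trans far (≤-reflexive (d-refl j))))
      ... | y , inj₂ (inj₂ refl) , far = ⊥-elim (<⇒≱ (proj₁ vj) far)
      result : Covers j i′ ⊎ Covers i j′
      result with a ≤? n
      ... | yes a≤n = inj₁ (between⇒covers {b = i} (subst (a ≤_) (sym ei) a≤n) (subst (_≤ b) (sym ei) n≤b))
      -- As `a > n`, the walk of `n` steps from `j` passes `i`, so only the wrapping case survives.
      ... | no a≰n with d-triangle i j j′
      ...   | inj₁ e = ⊥-elim (<⇒≱ (d<N i j′) (begin
              N ≡⟨ N≡n+n ⟩
              n + n ≤⟨ +-monoˡ-≤ n (<⇒≤ (≰⇒> a≰n)) ⟩
              a + n ≡⟨ cong (a +_) (sym ej) ⟩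
              a + D j j′ ≡⟨ e ⟩
              D i j′ ∎))
        where open ≤-Reasoning
      ...   | inj₂ e = inj₂ (+-cancelˡ-≤ N _ _ (begin
              N + D i j′ ≡⟨ sym e ⟩
              a + D j j′ ≡⟨ cong (a +_) ej ⟩
              a + n ≤⟨ +-monoˡ-≤ n a≤n+l ⟩
              n + l + n ≡⟨ +-comm (n + l) n ⟩
              n + (n + l) ≡⟨ sym (+-assoc n n l) ⟩
              n + n + l ≡⟨ cong (_+ l) (sym N≡n+n) ⟩
              N + l ∎))
        where open ≤-Reasoning

    -- If neither edge were the diameter, emptiness would put both on the same side of it, hence all
    -- four vertices in an open half circle.
    flip⇒diam : Empty i j → ∀ {δ} → Diam δ → OnEdge δ i ⊎ OnEdge δ j
    flip⇒diam emp {δ} diam with edge? δ i | edge? δ j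
    ... | yes p | _     = inj₁ p
    ... | no _  | yes q = inj₂ q
    ... | no ¬p | no ¬q = ⊥-elim (half (diam-mate diam) (¬p ∘ edge-trans (inj₂ refl))
            (¬q ∘ edge-trans (inj₂ refl)) (outside⇒inside-mate ¬p (half diam ¬p ¬q)))
      where
      half : ∀ {g} → Diam g → ¬ OnEdge g i → ¬ OnEdge g j → ¬ Inside g i
      half {g} dg ¬p ¬q ins = centered⇒¬window g λ
        { x (inj₁ r) → subst (_ <_) dg (proj₂ (inside-edge r ins))
        ; x (inj₂ r) → subst (_ <_) dg (proj₂ (inside-edge r
            (proj₁ (emp g [ ¬p ∘ edge-sym , ¬q ∘ edge-sym ]′) ins))) }

  -- Both points are off the short side of every edge, hence on the long side of every other
  -- non-diameter edge; a diameter can only be one of the two edges themselves.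
  ¬inside⇒empty : ∀ {i j} → (∀ g → Start g → ¬ Inside g i) → (∀ g → Start g → ¬ Inside g j) →
                  (∀ g → Diam g → OnQuad i j g) → Empty i j
  ¬inside⇒empty oi oj diam g off with trichotomy g
  ... | inj₁ st = ⊥-elim ∘ oi g st , ⊥-elim ∘ oj g st
  ... | inj₂ (inj₁ dg) = ⊥-elim (off (diam g dg))
  ... | inj₂ (inj₂ st) = (λ _ → must oj (off ∘ inj₂)) , (λ _ → must oi (off ∘ inj₁))
    where
    must : ∀ {k} → (∀ g → Start g → ¬ Inside g k) → ¬ OnEdge k g → Inside g k
    must {k} ok off = subst (λ h → Inside h k) (involutive g)
      (outside⇒inside-mate (off ∘ edge-sym ∘ edge-trans (inj₂ refl)) (ok (mate g) st))

  module Adjacent {s t s′ : Pt n} (vs : Vis s) (vt : Vis t) (es : D s s′ ≡ n) (c : Covers t s′) where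

    s≢t : s ≢ t
    s≢t refl = <⇒≱ (proj₁ vs) (subst (_≤ ℓ s) es c)

    private
      between : D s t ≤ D s s′ × D s s′ ≤ D s (mate t)
      between = covers⇒between (proj₂ (separate vs vt s≢t)) c

    ds≤n : D s t ≤ n
    ds≤n = subst (D s t ≤_) es (proj₁ between)

    -- The antipode of `s` lies between `t` and `mate t`, so `mate t` is far ahead of `s`, and `s`
    -- is far ahead of `t`. From `mate s` and `mate t` the far vertices are their own starts.
    adjacent-centered : Centered s t
    adjacent-centered _ (inj₁ (inj₁ refl)) =
      mate t , inj₂ (inj₂ refl) , subst (_≤ D s (mate t)) es (proj₂ between)
    adjacent-centered _ (inj₁ (inj₂ refl)) =
      s , inj₁ (inj₁ refl) , subst (n ≤_) (ℓ-mate s) (<⇒≤ (mate-far (proj₁ vs)))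
    adjacent-centered _ (inj₂ (inj₁ refl)) = s , inj₁ (inj₁ refl) , +-cancelˡ-≤ n _ _ (begin
      n + n         ≡⟨ sym N≡n+n ⟩
      N             ≡⟨ sym (d+d≡N s≢t) ⟩
      D s t + D t s ≤⟨ +-monoˡ-≤ (D t s) ds≤n ⟩
      n + D t s     ∎)
      where open ≤-Reasoning
    adjacent-centered _ (inj₂ (inj₂ refl)) =
      t , inj₂ (inj₁ refl) , subst (n ≤_) (ℓ-mate t) (<⇒≤ (mate-far (proj₁ vt)))

    -- `t` is at most `n` ahead of `s`. If `s` covers the antipode of `t`, the `n` steps from `t` to
    -- it complete the turn from `s`, so `t` is also at least `n` ahead.
    antipodal : ∀ {t′} → D t t′ ≡ n → Covers s t′ → D s t ≡ n
    antipodal {t′} et c′ = ≤-antisym ds≤n (+-cancelʳ-≤ n n _ (subst (_≤ D s t + n) N≡n+n N≤))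
      where
      N≤ : N ≤ D s t + n
      N≤ with d-triangle s t t′
      ... | inj₁ e = ⊥-elim (<⇒≱ (≤-<-trans c′ (proj₁ vs))
                       (subst₂ _≤_ et e (m≤n+m _ (D s t))))
      ... | inj₂ e = subst₂ _≤_ refl (trans (sym e) (cong (D s t +_) et)) (m≤m+n N _)

  -- Parity of intervals closed under the matching.

  Closed : Pt n → ℕ → ℕ → Set
  Closed b p q = ∀ x → p ≤ D b x → D b x < q → p ≤ D b (mate x) × D b (mate x) < q

  between⇒inside : ∀ b {g z} → D b g < D b z → D b z < D b (mate g) → Inside g z
  between⇒inside b {g} {z} p q =
    +-cancelˡ-< (D b g) _ _ (subst₂ _<_ (sym (+-identityʳ _)) (sym (rebase-≤ b (<⇒≤ p))) p) ,
    +-cancelˡ-< (D b g) _ _ (subst₂ _<_ (sym (rebase-≤ b (<⇒≤ p))) (sym (rebase-≤ b (<⇒≤ (<-trans p q)))) q)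

  inside⇒between : ∀ b {g z} → D b g < D b (mate g) → Inside g z → D b g < D b z × D b z < D b (mate g)
  inside⇒between b {g} {z} lt (p , q) with D b g ≤? D b z
  ... | yes le = subst₂ _<_ (+-identityʳ _) (rebase-≤ b le) (+-monoʳ-< (D b g) p) ,
                 subst₂ _<_ (rebase-≤ b le) (rebase-≤ b (<⇒≤ lt)) (+-monoʳ-< (D b g) q)
  ... | no ¬le = ⊥-elim (<⇒≱ (d<N b (mate g)) (≤-trans (m≤m+n N (D b z))
          (subst₂ _≤_ (rebase-> b (≰⇒> ¬le)) (rebase-≤ b (<⇒≤ lt)) (+-monoʳ-≤ (D b g) (<⇒≤ q)))))

  -- The edge at the first point of the interval splits it into two shorter closed ones.
  closed⇒even : ∀ b len p → p + len ≤ N → Closed b p (p + len) → Even len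
  closed⇒even b = <-rec _ λ
    { zero _ _ _ _ → 0 , refl
    ; (suc len) rec p bound closed → split len rec p bound closed }
    where
    split : ∀ len → (∀ {m} → m < suc len → ∀ p → p + m ≤ N → Closed b p (p + m) → Even m) →
            ∀ p → p + suc len ≤ N → Closed b p (p + suc len) → Even (suc len)
    -- `u` and `v` are half the lengths of the parts inside and after the first edge; the 1 counts
    -- that edge.
    split len rec p bound closed = u + v + 1 , eq
      where
      p<top : p < p + suc len
      p<top = m<m+n p z<s
      x : Pt n
      x = proj₁ (walk b p (<-≤-trans p<top bound))
      ex : D b x ≡ p
      ex = proj₂ (walk b p (<-≤-trans p<top bound))
      q : ℕ
      q = D b (mate x)
      cx : p ≤ q × q < p + suc len
      cx = closed x (≤-reflexive (sym ex)) (subst (_< p + suc len) (sym ex) p<top)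
      p<q : p < q
      p<q = ≤∧≢⇒< (proj₁ cx) (λ e → fixfree x (d-injective b (trans (sym e) (sym ex))))
      x<mx : D b x < D b (mate x)
      x<mx = subst (_< q) (sym ex) p<q
      m₁ m₂ : ℕ
      m₁ = q ∸ suc p
      m₂ = p + suc len ∸ suc q
      e₁ : suc p + m₁ ≡ q
      e₁ = m+[n∸m]≡n p<q
      e₂ : suc q + m₂ ≡ p + suc len
      e₂ = m+[n∸m]≡n (proj₂ cx)
      total : suc len ≡ 2 + (m₁ + m₂)
      total = +-cancelˡ-≡ p _ _ (trans (sym e₂) (trans (cong (λ k → suc k + m₂) (sym e₁)) (shuffle p m₁ m₂)))
        where
        shuffle : ∀ p a b → suc (suc p + a) + b ≡ p + (2 + (a + b))
        shuffle = solve-∀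
      closed₁ : Closed b (suc p) (suc p + m₁)
      closed₁ y lo hi = let ins = between⇒inside b (subst (_< D b y) (sym ex) lo) (subst (D b y <_) e₁ hi)
                            lo′ , hi′ = inside⇒between b x<mx (inside-mate ins)
                        in subst (_< D b (mate y)) ex lo′ , subst (D b (mate y) <_) (sym e₁) hi′
      closed₂ : Closed b (suc q) (suc q + m₂)
      closed₂ y lo hi = q<my , subst (D b (mate y) <_) (sym e₂) (proj₂ cy)
        where
        cy : p ≤ D b (mate y) × D b (mate y) < p + suc len
        cy = closed y (≤-trans (proj₁ cx) (<⇒≤ lo)) (subst (D b y <_) e₂ hi)
        q<my : q < D b (mate y)
        -- Otherwise `mate y` is `x`, `mate x`, or strictly inside that edge; then `y` is `mate x`,
        -- `x`, or inside as well, against `q < D b y`.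
        q<my = ≰⇒> λ le → let
            q≢my : D b (mate y) ≢ q
            q≢my e = <⇒≢ (<-trans p<q lo) (trans (sym ex)
              (cong (D b) (sym (trans (mate-swap (sym (d-injective b e))) (involutive x)))))
            p≢my : p ≢ D b (mate y)
            p≢my e = <-irrefl refl (subst (λ z → q < D b z) (mate-swap (d-injective b (trans ex e))) lo)
            ins : Inside x (mate y)
            ins = between⇒inside b
              (subst (_< D b (mate y)) (sym ex) (≤∧≢⇒< (proj₁ cy) p≢my)) (≤∧≢⇒< le q≢my)
          in <-asym lo (proj₂ (inside⇒between b x<mx (subst (Inside x) (involutive y) (inside-mate ins))))
      m₁<  : m₁ < suc len
      m₁< = subst (m₁ <_) (sym total) (≤-trans (s≤s (m≤m+n m₁ m₂)) (n≤1+n _))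
      m₂<  : m₂ < suc len
      m₂< = subst (m₂ <_) (sym total) (≤-trans (s≤s (m≤n+m m₂ m₁)) (n≤1+n _))
      b₁ : suc p + m₁ ≤ N
      b₁ = subst (_≤ N) (sym e₁) (≤-trans (<⇒≤ (proj₂ cx)) bound)
      b₂ : suc q + m₂ ≤ N
      b₂ = subst (_≤ N) (sym e₂) bound
      r₁ : Even m₁
      r₁ = rec m₁< (suc p) b₁ closed₁
      r₂ : Even m₂
      r₂ = rec m₂< (suc q) b₂ closed₂
      u v : ℕ
      u = proj₁ r₁
      v = proj₁ r₂
      eq : suc len ≡ 2 * (u + v + 1)
      eq = trans total (trans (cong₂ (λ a b → 2 + (a + b)) (proj₂ r₁) (proj₂ r₂)) (double u v))
        where
        double : ∀ u v → 2 + (2 * u + 2 * v) ≡ 2 * (u + v + 1)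
        double = solve-∀

  n≤N : n ≤ N
  n≤N = m≤m+n n (n + 0)

  -- The short arc of an edge leaving the `n` points from `s` to just before `t` would pass over `s`
  -- or `t`, or end there. Passing contradicts visibility; ending contradicts that `s` and `t` are
  -- starts.
  antipodal⇒even : (∀ g → ¬ Diam g) → ∀ {s t} → Vis s → Vis t → D s t ≡ n → Even n
  antipodal⇒even ¬diam {s} {t} (sts , vs) (stt , vt) est =
    closed⇒even s n 0 n≤N λ x _ lt → z≤n , near x lt
    where
    near : ∀ x → D s x < n → D s (mate x) < n
    near x lt = ≰⇒> λ far → case x lt far (trichotomy x)
      where
      case : ∀ x → D s x < n → n ≤ D s (mate x) → Start x ⊎ Diam x ⊎ Start (mate x) → ⊥
      case x lt far (inj₂ (inj₁ e)) = ¬diam x e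
      case x lt far (inj₁ st) with n ≟ D s (mate x)
      ... | yes e = start-mate st (subst Start (d-injective s (trans est e)) stt)
      ... | no ne = vt x st (between⇒inside s
              (subst (D s x <_) (sym est) lt) (subst (_< D s (mate x)) (sym est) (≤∧≢⇒< far ne)))
      case x lt far (inj₂ (inj₂ st)) with s Fin.≟ x
      ... | yes refl = start-mate sts st
      ... | no s≢x = vs (mate x) st (≢⇒0<d mx≢s , +-cancelˡ-< (D s (mate x)) _ _ (subst₂ _<_
              (sym (trans (d+d≡N (mx≢s ∘ sym)) (sym (+-identityʳ N))))
              (sym (trans (cong (D s (mate x) +_) (ℓ-mate x)) (rebase-> s (<-≤-trans lt far))))
              (+-monoʳ-< N (≢⇒0<d s≢x))))
        where
        mx≢s : mate x ≢ s
        mx≢s e = <⇒≱ (0<n s) (subst (n ≤_) (trans (cong (D s) e) (d-refl s)) far)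

  -- The `n ∸ 1` points strictly on one side of the diameter are matched among themselves.
  diam⇒odd : ∀ {g} → Diam g → Odd n
  diam⇒odd {g} dg = proj₁ ev , trans (sym 1+pred) (cong suc (proj₂ ev))
    where
    1+pred : 1 + (n ∸ 1) ≡ n
    1+pred = m+[n∸m]≡n (0<n g)
    ev : Even (n ∸ 1)
    ev = closed⇒even g (n ∸ 1) 1 (subst (_≤ N) (sym 1+pred) n≤N) λ x lo hi →
      let p , q = inside-mate {g} {x} (lo , subst (D g x <_) (trans 1+pred (sym dg)) hi)
      in p , subst (D g (mate x) <_) (trans dg (sym 1+pred)) q

  -- By `¬inside-diam` a second diameter can lie on neither side of the first.
  diam-unique : ∀ {δ g} → Diam δ → Diam g → OnEdge δ g
  diam-unique {δ} {g} dδ dg with edge? δ g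
  ... | yes p = p
  ... | no ¬p = ⊥-elim (¬inside-diam (≤-reflexive (diam-mate dδ)) dg
                  (outside⇒inside-mate ¬p (¬inside-diam (≤-reflexive dδ) dg)))

  -- A visible edge paired with a diameter.

  module WithDiameter {δ s : Pt n} (dδ : Diam δ) (vs : Vis s) where
    private
      -- `g` is the end of the diameter from which the edge at `s` lies within the next half turn,
      -- so `g` is far ahead of both ends of that edge; the ends of the diameter are far from each
      -- other.
      half : ∀ {g} → Diam g → OnEdge δ g → Inside g s → Centered s δ
      half {g} dg on ins = λ
        { x (inj₁ p) → g , inj₂ on , back (inside-edge p ins)
        ; x (inj₂ p) → mate x , inj₂ (edge-mate p) , ≤-reflexive (sym (diam p)) }
        where
        diam : ∀ {x} → OnEdge δ x → Diam x
        diam (inj₁ refl) = dδ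
        diam (inj₂ refl) = diam-mate dδ
        back : ∀ {x} → Inside g x → n ≤ D x g
        back {x} (lo , hi) = +-cancelˡ-≤ n _ _ (begin
          n + n         ≡⟨ sym N≡n+n ⟩
          N             ≡⟨ sym (d+d≡N (λ e → <-irrefl (trans (sym (d-refl g)) (cong (D g) e)) lo)) ⟩
          D g x + D x g ≤⟨ +-monoˡ-≤ (D x g) (<⇒≤ (subst (D g x <_) dg hi)) ⟩
          n + D x g     ∎)
          where open ≤-Reasoning

    diameter-centered : Centered s δ
    diameter-centered with inside? δ s
    ... | yes ins = half dδ (inj₁ refl) ins
    ... | no out = half (diam-mate dδ) (inj₂ refl) (outside⇒inside-mate (¬start×diam (proj₁ vs) dδ) out)

    diameter-empty : Empty s δ
    diameter-empty = ¬inside⇒empty (proj₂ vs)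
      (λ g st → ¬inside-diam (<⇒≤ st) dδ) (λ g dg → inj₂ (diam-unique dδ dg))

-- Boolean reflection.

¬T⇒T-not : ∀ {a} → ¬ T a → T (not a)
¬T⇒T-not {false} _ = tt
¬T⇒T-not {true}  f = f tt

T-not⇒¬T : ∀ {a} → T (not a) → ¬ T a
T-not⇒¬T {false} _ ()

T-implies⁻ : ∀ {a b} → T (not a ∨ b) → T a → T b
T-implies⁻ {true} t _ = t

T-implies⁺ : ∀ {a b} → (T a → T b) → T (not a ∨ b)
T-implies⁺ {true}  f = f tt
T-implies⁺ {false} _ = tt

T-not-xor⁻ : ∀ {a b} → T (not (a xor b)) → a ≡ b
T-not-xor⁻ {true}  {true}  _ = refl
T-not-xor⁻ {false} {false} _ = refl

T-not-xor⁺ : ∀ {a b} → (T a → T b) → (T b → T a) → T (not (a xor b))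
T-not-xor⁺ {true}  {true}  _ _ = tt
T-not-xor⁺ {true}  {false} f _ = f tt
T-not-xor⁺ {false} {true}  _ g = g tt
T-not-xor⁺ {false} {false} _ _ = tt

module _ {a b : Bool} where
  open Equivalence (T-∧ {a} {b}) public using () renaming (to to T-∧⁻; from to T-∧⁺)

-- Translation of the Boolean definitions into geometric predicates.

module Decode {n : ℕ} (M : Matching n) where
  open Matching M
  open Circle n
  open Geometry M

  Rep : Pt n → Set
  Rep i = T (isRep M i)

  opaque
    rep : ∀ x → ∃ λ r → OnEdge x r × Rep r
    rep x with <-cmp (toℕ x) (toℕ (mate x))
    ... | tri< lt _ _ = x , inj₁ refl , <⇒<ᵇ lt
    ... | tri≈ _ e _  = ⊥-elim (fixfree x (toℕ-injective (sym e)))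
    ... | tri> _ _ gt = mate x , inj₂ refl , <⇒<ᵇ (subst (λ z → toℕ (mate x) < toℕ z) (sym (involutive x)) gt)

  rep-unique : ∀ {i j} → Rep i → Rep j → OnEdge i j → i ≡ j
  rep-unique _ _ (inj₁ e) = sym e
  rep-unique {i} p q (inj₂ refl) = ⊥-elim (<-asym (<ᵇ⇒< _ _ p)
    (subst (λ z → toℕ (mate i) < toℕ z) (involutive i) (<ᵇ⇒< _ _ q)))

  differ⁺ : ∀ {i j} → i ≢ j → T (differ M i j)
  differ⁺ i≢j = ¬T⇒T-not (i≢j ∘ toℕ-injective ∘ ≡ᵇ⇒≡ _ _)

  differ⁻ : ∀ {i j} → T (differ M i j) → i ≢ j
  differ⁻ {i} t refl = T-not⇒¬T t (≡⇒≡ᵇ (toℕ i) (toℕ i) refl)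

  opaque
    unfolding D

    isDiameter⁺ : ∀ {g} → Diam g → T (isDiameter M g)
    isDiameter⁺ = ≡⇒≡ᵇ _ _

    isDiameter⁻ : ∀ {g} → T (isDiameter M g) → Diam g
    isDiameter⁻ = ≡ᵇ⇒≡ _ _

    -- Naming the short arc by its start `s` merges the two branches of `inShortArc` into
    -- `Inside s`.
    inShortArc⁻ : ∀ {g z} → ¬ Diam g → T (inShortArc M g z) → ∃ λ s → OnEdge g s × Start s × Inside s z
    inShortArc⁻ {g} {z} ¬d t with d n g (mate g) <ᵇ n in eq
    ... | true = g , inj₁ refl , <ᵇ⇒< _ _ (subst T (sym eq) tt) , arc⇒inside {g} {z} t
    ... | false with trichotomy g
    ...   | inj₁ st = ⊥-elim (subst T eq (<⇒<ᵇ st))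
    ...   | inj₂ (inj₁ e) = ⊥-elim (¬d e)
    ...   | inj₂ (inj₂ st) = mate g , inj₂ refl , st ,
            arc⇒inside {mate g} {z} (subst (λ h → T (arc n (mate g) h z)) (sym (involutive g)) t)

    inShortArc⁺ : ∀ {g s z} → OnEdge g s → Start s → Inside s z → T (inShortArc M g z)
    inShortArc⁺ {g} {s} {z} on st ins with d n g (mate g) <ᵇ n in eq | on
    ... | true  | inj₁ refl = inside⇒arc {g} {z} ins
    ... | true  | inj₂ refl = ⊥-elim (start-mate (<ᵇ⇒< _ _ (subst T (sym eq) tt)) st)
    ... | false | inj₁ refl = ⊥-elim (subst T eq (<⇒<ᵇ st))
    ... | false | inj₂ refl = subst (λ h → T (arc n (mate g) h z)) (involutive g) (inside⇒arc {mate g} {z} ins)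

    far⁺ : ∀ {x y} → n ≤ D x y → T (n ≤ᵇ d n x y)
    far⁺ = ≤⇒≤ᵇ

    far⁻ : ∀ {x y} → T (n ≤ᵇ d n x y) → n ≤ D x y
    far⁻ = ≤ᵇ⇒≤ _ _

  blocksRay⁻ : ∀ {g z} → T (blocksRay M g z) → ∃ λ s → OnEdge g s × Start s × Inside s z
  blocksRay⁻ t with T-∧⁻ t
  ... | p , q = inShortArc⁻ (T-not⇒¬T p ∘ isDiameter⁺) q

  blocksRay⁺ : ∀ {g s z} → OnEdge g s → Start s → Inside s z → T (blocksRay M g z)
  blocksRay⁺ on st ins = T-∧⁺ (¬T⇒T-not (λ t → ¬start×diam st (isDiameter⁻ t) on) , inShortArc⁺ on st ins)

  VisibleEdge : Pt n → Set
  VisibleEdge i = ∃ λ s → OnEdge i s × Vis s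

  visible⁻ : ∀ {i} → T (visible M i) → Rep i × VisibleEdge i
  visible⁻ {i} t with T-∧⁻ t
  ... | r , t′ with T-∧⁻ t′
  ...   | ¬d , a = r , edge (trichotomy i)
    where
    out : ∀ {x} → OnEdge i x → ∀ g → Start g → ¬ Inside g x
    out {x} on g st ins with rep g
    ... | r , onr , repr = T-not⇒¬T
          (T-implies⁻ (All.lookup (All.all⁺ _ (allFin (2 * n)) a) (∈-allFin r)) (T-∧⁺ (repr , differ⁺ off)))
          (Equivalence.from T-∨ (inj₁ (blocksRay⁺ (edge-sym onr) st (inside-edge (edge-sym on) ins))))
      where
      -- The definition tests only other edges; an edge's own arc never strictly contains its
      -- endpoints.
      off : r ≢ i
      off refl = inside-off ins (edge-trans onr on)
    edge : Start i ⊎ Diam i ⊎ Start (mate i) → VisibleEdge i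
    edge (inj₁ st) = i , inj₁ refl , st , out (inj₁ refl)
    edge (inj₂ (inj₁ e)) = ⊥-elim (T-not⇒¬T ¬d (isDiameter⁺ e))
    edge (inj₂ (inj₂ st)) = mate i , inj₂ refl , st , out (inj₂ refl)

  visible⁺ : ∀ {i} → Rep i → VisibleEdge i → T (visible M i)
  visible⁺ {i} r (s , on , st , out) = T-∧⁺ (r , T-∧⁺
    ( ¬T⇒T-not (λ t → ¬start×diam st (isDiameter⁻ t) on)
    , All.all⁻ _ (All.tabulate {xs = allFin (2 * n)} λ {g} _ →
        T-implies⁺ {isRep M g ∧ differ M g i} λ _ → ¬T⇒T-not {blocksRay M g i ∨ blocksRay M g (mate i)}
          ([ blocks {g} (inj₁ refl) , blocks {g} (inj₂ refl) ]′ ∘ Equivalence.to T-∨))))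
    where
    blocks : ∀ {g z} → OnEdge i z → ¬ T (blocksRay M g z)
    blocks onz t with blocksRay⁻ t
    ... | s′ , _ , st′ , ins = out s′ st′ (inside-edge (edge-trans (edge-sym onz) on) ins)

  -- The Boolean test ranges over representatives only. If `mate g` is the representative, the sides
  -- are exchanged and the implications for `g` follow by contraposition.
  emptyQuad⁻ : ∀ {i j} → T (emptyQuad M i j) → Empty i j
  emptyQuad⁻ {i} {j} t g off with rep g
  ... | r , onr , repr = [ here′ , there′ ]′ onr
    where
    same : arc n r (mate r) i ≡ arc n r (mate r) j
    same = T-not-xor⁻ (T-implies⁻ (All.lookup (All.all⁺ _ (allFin (2 * n)) t) (∈-allFin r))
      (T-∧⁺ (repr , T-∧⁺ {differ M r i} {differ M r j}
        ( differ⁺ {r} {i} (λ { refl → off (inj₁ (edge-sym onr)) })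
        , differ⁺ {r} {j} (λ { refl → off (inj₂ (edge-sym onr)) })))))
    i⇒j : Inside r i → Inside r j
    i⇒j = arc⇒inside ∘ subst T same ∘ inside⇒arc
    j⇒i : Inside r j → Inside r i
    j⇒i = arc⇒inside ∘ subst T (sym same) ∘ inside⇒arc
    here′ : r ≡ g → (Inside g i → Inside g j) × (Inside g j → Inside g i)
    here′ refl = i⇒j , j⇒i
    there′ : r ≡ mate g → (Inside g i → Inside g j) × (Inside g j → Inside g i)
    there′ refl = flip inj₂ j⇒i , flip inj₁ i⇒j
      where
      flip : ∀ {k l} → (∀ {x} → OnEdge l x → OnQuad i j x) →
             (Inside (mate g) l → Inside (mate g) k) → Inside g k → Inside g l
      flip {k} {l} side f ins = subst (λ h → Inside h l) (involutive g)
        (outside⇒inside-mate (λ on → off (side (edge-sym (edge-trans (inj₂ refl) on))))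
          λ ins′ → ¬inside-both ins (f ins′))

  emptyQuad⁺ : ∀ {i j} → Rep i → Rep j → Empty i j → T (emptyQuad M i j)
  emptyQuad⁺ {i} {j} ri rj emp =
    All.all⁻ _ (All.tabulate {xs = allFin (2 * n)} λ {g} _ → T-implies⁺ (check g))
    where
    check : ∀ g → T (isRep M g ∧ differ M g i ∧ differ M g j) →
            T (not (arc n g (mate g) i xor arc n g (mate g) j))
    check g t with T-∧⁻ t
    ... | r , t′ with T-∧⁻ t′
    ...   | g≠i , g≠j with emp g [ differ⁻ g≠i ∘ sym ∘ rep-unique ri r
                                 , differ⁻ g≠j ∘ sym ∘ rep-unique rj r ]′
    ...     | f , f′ = T-not-xor⁺ (inside⇒arc ∘ f ∘ arc⇒inside) (inside⇒arc ∘ f′ ∘ arc⇒inside)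

  quad : Pt n → Pt n → List (Pt n)
  quad i j = i ∷ mate i ∷ j ∷ mate j ∷ []

  ∈quad⁺ : ∀ {i j x} → OnQuad i j x → x ∈ quad i j
  ∈quad⁺ (inj₁ (inj₁ e)) = here e
  ∈quad⁺ (inj₁ (inj₂ e)) = there (here e)
  ∈quad⁺ (inj₂ (inj₁ e)) = there (there (here e))
  ∈quad⁺ (inj₂ (inj₂ e)) = there (there (there (here e)))

  ∈quad⁻ : ∀ {i j x} → x ∈ quad i j → OnQuad i j x
  ∈quad⁻ (here e) = inj₁ (inj₁ e)
  ∈quad⁻ (there (here e)) = inj₁ (inj₂ e)
  ∈quad⁻ (there (there (here e))) = inj₂ (inj₁ e)
  ∈quad⁻ (there (there (there (here e)))) = inj₂ (inj₂ e)

  hasFar : Pt n → Pt n → Pt n → Bool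
  hasFar i j x = any (λ y → n ≤ᵇ d n x y) (quad i j)

  centered⁻ : ∀ {i j} → T (centered M i j) → Centered i j
  centered⁻ {i} {j} t x on with find (Any.any⁻ (λ y → n ≤ᵇ d n x y) (quad i j)
                                  (All.lookup (All.all⁺ (hasFar i j) (quad i j) t) (∈quad⁺ on)))
  ... | y , y∈ , far = y , ∈quad⁻ y∈ , far⁻ far

  centered⁺ : ∀ {i j} → Centered i j → T (centered M i j)
  centered⁺ {i} {j} cen = All.all⁻ (hasFar i j) (All.tabulate {xs = quad i j} λ {x} x∈ →
    let y , on , far = cen x (∈quad⁻ x∈) in Any.any⁺ (λ y → n ≤ᵇ d n x y) (lose (∈quad⁺ on) (far⁺ far)))

  record Flip (i j : Pt n) : Set where
    field
      repˡ : Rep i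
      repʳ : Rep j
      ordered : toℕ i < toℕ j
      empty : Empty i j
      centred : Centered i j

  flip⁻ : ∀ {i j} → T (centeredFlip M i j) → Flip i j
  flip⁻ t with T-∧⁻ t
  ... | ri , t₁ with T-∧⁻ t₁
  ...   | rj , t₂ with T-∧⁻ t₂
  ...     | lt , t₃ with T-∧⁻ t₃
  ...       | e , c = record { repˡ = ri ; repʳ = rj ; ordered = <ᵇ⇒< _ _ lt
                             ; empty = emptyQuad⁻ e ; centred = centered⁻ c }

  flip⁺ : ∀ {i j} → Flip i j → T (centeredFlip M i j)
  flip⁺ f = T-∧⁺ (repˡ , T-∧⁺ (repʳ , T-∧⁺ (<⇒<ᵇ ordered ,
    T-∧⁺ (emptyQuad⁺ repˡ repʳ empty , centered⁺ centred))))
    where open Flip f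

  empty-sym : ∀ {i j} → Empty i j → Empty j i
  empty-sym emp g off = swap (emp g (off ∘ Sum.swap))

  centered-sym : ∀ {i j} → Centered i j → Centered j i
  centered-sym cen x on = let y , on′ , far = cen x (Sum.swap on) in y , Sum.swap on′ , far

  module _ {i j i′ j′} (oi : OnEdge i i′) (oj : OnEdge j j′) where
    quad-edge : ∀ {x} → OnQuad i j x → OnQuad i′ j′ x
    quad-edge = Sum.map (edge-trans (edge-sym oi)) (edge-trans (edge-sym oj))

    empty-edge : Empty i j → Empty i′ j′
    empty-edge emp g off with emp g (off ∘ quad-edge)
    ... | f , f′ = inside-edge oj ∘ f ∘ inside-edge (edge-sym oi) ,
                   inside-edge oi ∘ f′ ∘ inside-edge (edge-sym oj)

  centered-edge : ∀ {i j i′ j′} → OnEdge i i′ → OnEdge j j′ → Centered i j → Centered i′ j′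
  centered-edge oi oj cen x on with cen x (quad-edge (edge-sym oi) (edge-sym oj) on)
  ... | y , on′ , far = y , quad-edge oi oj on′ , far

  -- Flips are listed with the smaller index first, hence the two outcomes.
  mkFlip : ∀ {i j} → Rep i → Rep j → i ≢ j → Empty i j → Centered i j →
           T (centeredFlip M i j) ⊎ T (centeredFlip M j i)
  mkFlip {i} {j} ri rj i≢j e c with <-cmp (toℕ i) (toℕ j)
  ... | tri< lt _ _ = inj₁ (flip⁺ (record { repˡ = ri ; repʳ = rj ; ordered = lt ; empty = e ; centred = c }))
  ... | tri≈ _ eq _ = ⊥-elim (i≢j (toℕ-injective eq))
  ... | tri> _ _ gt = inj₂ (flip⁺ (record { repˡ = rj ; repʳ = ri ; ordered = gt
                                          ; empty = empty-sym e ; centred = centered-sym c }))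

  flip-≢ : ∀ {i j} → Flip i j → ¬ OnEdge i j
  flip-≢ f on = <-irrefl (cong toℕ (rep-unique repˡ repʳ on)) ordered
    where open Flip f

  -- Matchings without a diameter.

  module NoDiameter (¬diam : ∀ g → ¬ Diam g) where

    opaque
      start : ∀ i → ∃ λ s → OnEdge i s × Start s
      start i with trichotomy i
      ... | inj₁ st = i , inj₁ refl , st
      ... | inj₂ (inj₁ e) = ⊥-elim (¬diam i e)
      ... | inj₂ (inj₂ st) = mate i , inj₂ refl , st

    opposite : Pt n → Pt n
    opposite i = proj₁ (antipode (proj₁ (start i)))

    start≡ : ∀ {i s} → OnEdge i s → Start s → proj₁ (start i) ≡ s
    start≡ {i} on st with start i
    ... | s′ , on′ , st′ = start-unique st′ st (edge-trans (edge-sym on′) on)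

    antipode-opposite : ∀ {i s} → OnEdge i s → Start s → D s (opposite i) ≡ n
    antipode-opposite {i} {s} on st =
      subst (λ z → D z (opposite i) ≡ n) (start≡ on st) (proj₂ (antipode (proj₁ (start i))))

    opaque
      partner : ∀ i → ∃ λ j → Rep j × ∃ λ t → OnEdge j t × Vis t × Covers t (opposite i)
      partner i with cover ¬diam (opposite i)
      ... | t , vt , c with rep t
      ...   | r , onr , repr = r , repr , t , edge-sym onr , vt , c

    h : Pt n → Pt n
    h i = proj₁ (partner i)

    -- `cover-unique` identifies any visible cover of the opposite point with the one chosen by
    -- `partner`.
    covers⇒h : ∀ {i j t} → Rep j → OnEdge j t → Vis t → Covers t (opposite i) → h i ≡ j
    covers⇒h {i} {j} {t} rj on vt c =
      let _ , rj′ , t′ , on′ , vt′ , c′ = partner i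
      in rep-unique rj′ rj (edge-trans on′ (edge-sym (subst (OnEdge j) (cover-unique vt vt′ c c′) on)))

    h-covers : ∀ i → Rep (h i) × ∃ λ t → OnEdge (h i) t × Vis t × Covers t (opposite i)
    h-covers i = proj₂ (partner i)

    flip-visible : ∀ {i j} → Flip i j → VisibleEdge i × VisibleEdge j
    flip-visible {i} {j} f =
      vis i (flip⇒¬inside centred empty) ,
      vis j (flip⇒¬inside (centered-sym centred) (empty-sym empty))
      where
      open Flip f
      vis : ∀ k → (∀ g → Start g → ¬ Inside g k) → VisibleEdge k
      vis k out with start k
      ... | s , on , st = s , on , st , λ g stg ins → out g stg (inside-edge (edge-sym on) ins)

    -- Flips use visible edges only, and by `flip⇒adjacent` one of the two covers the antipode of
    -- the other's start.
    R⇒h : ∀ i j → T (centeredFlip M i j) → (T (visible M i) × h i ≡ j) ⊎ (T (visible M j) × h j ≡ i)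
    R⇒h i j t with flip⁻ t
    ... | f with flip-visible f
    ...   | vi@(s , ons , vs) , vj@(u , onu , vu) = Sum.map
            (λ c → visible⁺ repˡ vi , covers⇒h repʳ onu vu c)
            (λ c → visible⁺ repʳ vj , covers⇒h repˡ ons vs c)
            (flip⇒adjacent (centered-edge ons onu centred) vs vu
              (λ { refl → flip-≢ f (edge-trans ons (edge-sym onu)) })
              (antipode-opposite ons (proj₁ vs)) (antipode-opposite onu (proj₁ vu)))
      where open Flip f

    h⇒R : ∀ i → T (visible M i) → T (centeredFlip M i (h i)) ⊎ T (centeredFlip M (h i) i)
    h⇒R i v with visible⁻ v | h-covers i
    ... | ri , s , ons , vs | rh , u , onu , vu , c = mkFlip ri rh
          (λ e → A.s≢t (start-unique (proj₁ vs) (proj₁ vu)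
            (edge-trans (edge-sym ons) (subst (λ z → OnEdge z u) (sym e) onu))))
          (empty-edge (edge-sym ons) (edge-sym onu)
            (¬inside⇒empty (proj₂ vs) (proj₂ vu) (λ g dg → ⊥-elim (¬diam g dg))))
          (centered-edge (edge-sym ons) (edge-sym onu) A.adjacent-centered)
      where module A = Adjacent vs vu (antipode-opposite ons (proj₁ vs)) c

    private
      module G = FunctionalGraph (visible M) (centeredFlip M) h (λ _ _ → Flip.ordered ∘ flip⁻) R⇒h h⇒R

    flips≤visible : numCenteredFlips M ≤ numVisible M
    flips≤visible = G.#R≤#V

    visible≤2*flips : numVisible M ≤ 2 * numCenteredFlips M
    visible≤2*flips = G.#V≤2*#R

    -- A 2-cycle of `h` would make two visible starts antipodal.
    flips≡visible : (∀ {s t} → Vis s → Vis t → D s t ≢ n) → numCenteredFlips M ≡ numVisible M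
    flips≡visible far = G.#R≡#V λ i j vi vj hi≡j hj≡i → acyclic i j vi hi≡j hj≡i
      where
      acyclic : ∀ i j → T (visible M i) → h i ≡ j → h j ≢ i
      acyclic i j vi refl hj≡i with visible⁻ vi | h-covers i | h-covers (h i)
      ... | ri , s , ons , vs | rh , u , onu , vu , c | rh′ , w , onw , vw , c′
        with start-unique (proj₁ vs) (proj₁ vw) (edge-trans (edge-sym ons) (subst (λ z → OnEdge z w) hj≡i onw))
      ...   | refl = far vs vu (Adjacent.antipodal vs vu
              (antipode-opposite ons (proj₁ vs)) c (antipode-opposite onu (proj₁ vu)) c′)

    -- On at most two visible edges `h`, which has no fixed point there, must exchange them, so
    -- every flip is a 2-cycle.
    visible≡2*flips : ∀ x y → (∀ i → T (visible M i) → i ≡ x ⊎ i ≡ y) →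
                      numVisible M ≡ 2 * numCenteredFlips M
    visible≡2*flips x y two = G.#V≡2*#R (λ i j r → mateˡ r , mateʳ r) inV
      where
      inV : ∀ i j → T (centeredFlip M i j) → T (visible M i) × T (visible M j)
      inV i j t with flip⁻ t
      ... | f = let vi , vj = flip-visible f in visible⁺ (Flip.repˡ f) vi , visible⁺ (Flip.repʳ f) vj
      third : ∀ {i j k} → i ≢ j → i ≢ k → T (visible M i) → T (visible M j) → T (visible M k) → k ≡ j
      third {i} {j} {k} ij ik vi vj vk with two i vi | two j vj | two k vk
      ... | inj₁ refl | inj₁ refl | _ = ⊥-elim (ij refl)
      ... | inj₁ refl | inj₂ refl | inj₁ refl = ⊥-elim (ik refl)
      ... | inj₁ refl | inj₂ refl | inj₂ e = e
      ... | inj₂ refl | inj₂ refl | _ = ⊥-elim (ij refl)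
      ... | inj₂ refl | inj₁ refl | inj₂ refl = ⊥-elim (ik refl)
      ... | inj₂ refl | inj₁ refl | inj₁ e = e
      flip≢ : ∀ i j → T (centeredFlip M i j) → i ≢ j
      flip≢ i j t refl = <-irrefl refl (Flip.ordered (flip⁻ t))
      h-visible : ∀ i → T (visible M i) → i ≢ h i × T (visible M (h i))
      h-visible i v = [ (λ r → flip≢ i (h i) r , proj₂ (inV i (h i) r))
                      , (λ r → flip≢ (h i) i r ∘ sym , proj₁ (inV (h i) i r)) ]′ (h⇒R i v)
      mateˡ : ∀ {i j} → T (centeredFlip M i j) → h i ≡ j
      mateˡ {i} {j} r =
        let vi , vj = inV i j r ; ne , vh = h-visible i vi in third (flip≢ i j r) ne vi vj vh
      mateʳ : ∀ {i j} → T (centeredFlip M i j) → h j ≡ i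
      mateʳ {i} {j} r =
        let vi , vj = inV i j r ; ne , vh = h-visible j vj in third (flip≢ i j r ∘ sym) ne vj vi vh

  -- Matchings with a diameter.

  module HasDiameter {δ : Pt n} (dδ : Diam δ) where
    private
      r : Pt n
      r = proj₁ (rep δ)
      onr : OnEdge δ r
      onr = proj₁ (proj₂ (rep δ))
      repr : Rep r
      repr = proj₂ (proj₂ (rep δ))

      vis : ∀ {k} → ¬ OnEdge δ k → (∀ g → Start g → ¬ Inside g k) → VisibleEdge k
      vis {k} off out with trichotomy k
      ... | inj₁ st = k , inj₁ refl , st , out
      ... | inj₂ (inj₁ e) = ⊥-elim (off (diam-unique dδ e))
      ... | inj₂ (inj₂ st) = mate k , inj₂ refl , st , λ g stg ins →
              out g stg (subst (Inside g) (involutive k) (inside-mate ins))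

      R⇒h : ∀ i j → T (centeredFlip M i j) → (T (visible M i) × r ≡ j) ⊎ (T (visible M j) × r ≡ i)
      R⇒h i j t with flip⁻ t
      ... | f with flip⇒diam (Flip.centred f) (Flip.empty f) dδ
      ...   | inj₁ on = inj₂ (visible⁺ repʳ (vis (λ on′ → flip-≢ f (edge-trans (edge-sym on) on′))
                                (flip⇒¬inside (centered-sym centred) (empty-sym empty)))
                             , rep-unique repr repˡ (edge-trans (edge-sym onr) on))
        where open Flip f
      ...   | inj₂ on = inj₁ (visible⁺ repˡ (vis (λ on′ → flip-≢ f (edge-trans (edge-sym on′) on))
                                (flip⇒¬inside centred empty))
                             , rep-unique repr repʳ (edge-trans (edge-sym onr) on))
        where open Flip f

      ¬visible-r : ∀ {i} → T (visible M i) → i ≢ r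
      ¬visible-r v refl with visible⁻ v
      ... | _ , s , on , vs = ¬start×diam (proj₁ vs) dδ (edge-trans onr on)

      h⇒R : ∀ i → T (visible M i) → T (centeredFlip M i r) ⊎ T (centeredFlip M r i)
      h⇒R i v with visible⁻ v
      ... | ri , s , on , vs = mkFlip ri repr (¬visible-r v)
            (empty-edge (edge-sym on) onr (WithDiameter.diameter-empty dδ vs))
            (centered-edge (edge-sym on) onr (WithDiameter.diameter-centered dδ vs))

    -- Here `h` is constant with the diameter as its value. The diameter is not visible, so there
    -- are no 2-cycles.
    flips≡visible : numCenteredFlips M ≡ numVisible M
    flips≡visible = FunctionalGraph.#R≡#V (visible M) (centeredFlip M) (λ _ → r)
      (λ _ _ → Flip.ordered ∘ flip⁻) R⇒h h⇒R (λ { i j vi vj refl _ → ¬visible-r vj refl })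

  ¬even×odd : Even n → ¬ Odd n
  ¬even×odd (a , p) (b , q) = even≢odd a b (trans (sym p) q)

  odd⇒flips≡visible : Odd n → numCenteredFlips M ≡ numVisible M
  odd⇒flips≡visible odd with any? (λ g → ℓ g ≟ n)
  ... | yes (δ , dδ) = HasDiameter.flips≡visible dδ
  ... | no none = NoDiameter.flips≡visible ¬diam λ vs vt e → ¬even×odd (antipodal⇒even ¬diam vs vt e) odd
    where
    ¬diam : ∀ g → ¬ Diam g
    ¬diam g dg = none (g , dg)

  even⇒¬diam : Even n → ∀ g → ¬ Diam g
  even⇒¬diam even g dg = ¬even×odd even (diam⇒odd dg)

-- Non-crossing matchings from nested pairings of linearly ordered indices.

T-⇔⇒≡ : ∀ {a b} → (T a → T b) → (T b → T a) → a ≡ b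
T-⇔⇒≡ f g = T-not-xor⁻ (T-not-xor⁺ f g)

module LinearArc {N x y z : ℕ} (x<N : x < N) (z<N : z < N) where

  private
    T-inArc⁻ : T (inArc N x y z) → 0 < dist N x z × dist N x z < dist N x y
    T-inArc⁻ t with T-∧⁻ {0 <ᵇ dist N x z} t
    ... | p , q = <ᵇ⇒< _ _ p , <ᵇ⇒< _ _ q

    T-inArc⁺ : 0 < dist N x z → dist N x z < dist N x y → T (inArc N x y z)
    T-inArc⁺ p q = T-∧⁺ (<⇒<ᵇ p , <⇒<ᵇ q)

  arc-<⁻ : x < y → y < N → T (inArc N x y z) → x < z × z < y
  arc-<⁻ x<y y<N t with T-inArc⁻ t | dist-steps {N} x z (<⇒≤ x<N) | dist-≤ {N} (<⇒≤ x<y)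
  ... | p , q | inj₁ (_ , e) | f =
        subst₂ _<_ (+-identityʳ x) e (+-monoʳ-< x p) , subst₂ _<_ e f (+-monoʳ-< x q)
  ... | p , q | inj₂ (_ , e) | f =
        ⊥-elim (<⇒≱ y<N (≤-trans (m≤m+n N z) (<⇒≤ (subst₂ _<_ e f (+-monoʳ-< x q)))))

  arc-<⁺ : x < z → z < y → T (inArc N x y z)
  arc-<⁺ x<z z<y = T-inArc⁺
    (+-cancelˡ-< x _ _ (subst₂ _<_ (sym (+-identityʳ x)) (sym (dist-≤ {N} (<⇒≤ x<z))) x<z))
    (+-cancelˡ-< x _ _ (subst₂ _<_ (sym (dist-≤ {N} (<⇒≤ x<z)))
      (sym (dist-≤ {N} (<⇒≤ (<-trans x<z z<y)))) z<y))

  arc->⁻ : y < x → T (inArc N x y z) → x < z ⊎ z < y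
  arc->⁻ y<x t with T-inArc⁻ t | dist-steps {N} x z (<⇒≤ x<N) | dist-> (<⇒≤ x<N) y<x
  ... | p , q | inj₁ (_ , e) | f = inj₁ (subst₂ _<_ (+-identityʳ x) e (+-monoʳ-< x p))
  ... | p , q | inj₂ (_ , e) | f = inj₂ (+-cancelˡ-< N _ _ (subst₂ _<_ e f (+-monoʳ-< x q)))

  arc->⁺ : y < x → x < z ⊎ z < y → T (inArc N x y z)
  arc->⁺ y<x (inj₁ x<z) = T-inArc⁺
    (+-cancelˡ-< x _ _ (subst₂ _<_ (sym (+-identityʳ x)) (sym (dist-≤ {N} (<⇒≤ x<z))) x<z))
    (+-cancelˡ-< x _ _ (subst₂ _<_ (sym (dist-≤ {N} (<⇒≤ x<z)))
      (sym (dist-> (<⇒≤ x<N) y<x)) (<-≤-trans z<N (m≤m+n N y))))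
  arc->⁺ y<x (inj₂ z<y) = T-inArc⁺
    (+-cancelˡ-< x _ _ (subst₂ _<_ (sym (+-identityʳ x)) (sym dz) (<-≤-trans x<N (m≤m+n N z))))
    (+-cancelˡ-< x _ _ (subst₂ _<_ (sym dz) (sym (dist-> (<⇒≤ x<N) y<x)) (+-monoʳ-< N z<y)))
    where
    dz : x + dist N x z ≡ N + z
    dz = dist-> (<⇒≤ x<N) (<-trans z<y y<x)

module _ {n : ℕ} (mate : Pt n → Pt n)
  (involutive : ∀ i → mate (mate i) ≡ i) (fixfree : ∀ i → mate i ≢ i)
  (nested : ∀ i j → toℕ i < toℕ j → toℕ j < toℕ (mate i) →
            toℕ i < toℕ (mate j) × toℕ (mate j) < toℕ (mate i))
  where

  private
    open LinearArc

    -- Only one direction is proved here; `linearMatching` gets the other by applying it to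
    -- `mate j`.
    half : ∀ i j → j ≢ i → j ≢ mate i → T (arc n i (mate i) j) → T (arc n i (mate i) (mate j))
    half i j j≢i j≢mi t with <-cmp (toℕ i) (toℕ (mate i))
    ... | tri≈ _ e _ = ⊥-elim (fixfree i (toℕ-injective (sym e)))
    ... | tri< lt _ _ =
          let p , q = arc-<⁻ (toℕ<n i) (toℕ<n j) lt (toℕ<n (mate i)) t
              p′ , q′ = nested i j p q
          in arc-<⁺ (toℕ<n i) (toℕ<n (mate j)) p′ q′
    ... | tri> _ _ gt = arc->⁺ (toℕ<n i) (toℕ<n (mate j)) gt
            (outside (arc->⁻ (toℕ<n i) (toℕ<n j) gt t))
      where
      outside : toℕ i < toℕ j ⊎ toℕ j < toℕ (mate i) → toℕ i < toℕ (mate j) ⊎ toℕ (mate j) < toℕ (mate i)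
      outside out with <-cmp (toℕ i) (toℕ (mate j)) | <-cmp (toℕ (mate j)) (toℕ (mate i))
      ... | tri< p _ _ | _ = inj₁ p
      ... | tri≈ _ e _ | _ = ⊥-elim (j≢mi (trans (sym (involutive j)) (cong mate (sym (toℕ-injective e)))))
      ... | _ | tri< p _ _ = inj₂ p
      ... | _ | tri≈ _ e _ = ⊥-elim (j≢i (trans (sym (involutive j))
              (trans (cong mate (toℕ-injective e)) (involutive i))))
      -- Now `mate j` lies strictly between `mate i` and `i`; nesting puts `j` there as well, hence
      -- off the arc that wraps past index 0.
      ... | tri> _ _ p | tri> _ _ q
        with nested (mate i) (mate j) q (subst (λ k → toℕ (mate j) < toℕ k) (sym (involutive i)) p)
      ...   | a , b = ⊥-elim (
              [ (λ o → <-asym o (subst₂ _<_ (cong toℕ (involutive j)) (cong toℕ (involutive i)) b))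
              , (λ o → <-asym o (subst (toℕ (mate i) <_) (cong toℕ (involutive j)) a)) ]′ out)

  linearMatching : Matching n
  linearMatching = record
    { mate = mate ; involutive = involutive ; fixfree = fixfree
    ; noncrossing = λ i j p q → T-⇔⇒≡ (half i j p q) λ t →
        subst (T ∘ arc n i (mate i)) (involutive j)
          (half i (mate j)
            (λ e → q (trans (sym (involutive j)) (cong mate e)))
            (λ e → p (trans (sym (involutive j)) (trans (cong mate e) (involutive i)))) t) }

-- A partition of the points into blocks [lo x , hi x]; each is matched by reflection.
record IsBlock (n : ℕ) (lo hi : ℕ → ℕ) (a b : ℕ) : Set where
  field
    end<  : b < 2 * n
    odd   : Odd (a + b)
    short : b < a + n
    const : ∀ {y} → a ≤ y → y ≤ b → lo y ≡ a × hi y ≡ b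

record Blocks (n : ℕ) : Set where
  field
    lo hi : ℕ → ℕ
    locate  : ∀ {x} → x < 2 * n → ∃₂ λ a b → a ≤ x × x ≤ b × IsBlock n lo hi a b

-- Reflection in blocks and its visible edges.

module BlockMatching {n : ℕ} (𝓑 : Blocks n) where
  open Blocks 𝓑

  module _ {x : ℕ} (x<N : x < 2 * n) where

    private
      own : lo x ≤ x × x ≤ hi x × IsBlock n lo hi (lo x) (hi x)
      own with locate x<N
      ... | a , b , p , q , B with IsBlock.const B p q
      ...   | refl , refl = p , q , B

    lo≤ : lo x ≤ x
    lo≤ = proj₁ own

    ≤hi : x ≤ hi x
    ≤hi = proj₁ (proj₂ own)

    open IsBlock (proj₂ (proj₂ own)) public renaming (end< to hi<; const to block)

  σ : ℕ → ℕ
  σ x = lo x + hi x ∸ x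

  module _ {x : ℕ} (x<N : x < 2 * n) where
    σ-sum : σ x + x ≡ lo x + hi x
    σ-sum = m∸n+n≡m (≤-trans (≤hi x<N) (m≤n+m _ _))

    lo≤σ : lo x ≤ σ x
    lo≤σ = +-cancelʳ-≤ x _ _ (subst (lo x + x ≤_) (sym σ-sum) (+-monoʳ-≤ (lo x) (≤hi x<N)))

    σ≤hi : σ x ≤ hi x
    σ≤hi = +-cancelʳ-≤ x _ _ (subst₂ _≤_ (sym σ-sum) (+-comm x (hi x)) (+-monoˡ-≤ (hi x) (lo≤ x<N)))

    σ<N : σ x < 2 * n
    σ<N = ≤-<-trans σ≤hi (hi< x<N)

    σ-sum-block : ∀ {y} → y < 2 * n → lo x ≤ y → y ≤ hi x → σ y + y ≡ σ x + x
    σ-sum-block y<N p q with block x<N p q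
    ... | e , f = trans (m∸n+n≡m (≤-trans (≤hi y<N) (m≤n+m _ _))) (trans (cong₂ _+_ e f) (sym σ-sum))

    σσ : σ (σ x) ≡ x
    σσ = +-cancelʳ-≡ (σ x) _ _ (trans (σ-sum-block σ<N lo≤σ σ≤hi) (+-comm (σ x) x))

    -- A fixed point would make the odd number `lo x + hi x` equal to `2 * x`.
    σ≢ : σ x ≢ x
    σ≢ e with odd x<N
    ... | k , f = even≢odd x k (trans (cong (x +_) (+-identityʳ x))
                    (trans (cong (_+ x) (sym e)) (trans σ-sum f)))

    -- `σ y + y` is constant on a block, so `σ` reverses the order there.
    σ-nested : ∀ {y} → y < 2 * n → x < y → y < σ x → x < σ y × σ y < σ x
    σ-nested {y} y<N p q =
      ≰⇒> (λ le → <-irrefl (trans eq (+-comm (σ x) x)) (+-mono-≤-< le q)) ,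
      ≰⇒> (λ le → <-irrefl (sym eq) (+-mono-≤-< le p))
      where
      eq : σ y + y ≡ σ x + x
      eq = σ-sum-block y<N (≤-trans (lo≤ x<N) (<⇒≤ p)) (≤-trans (<⇒≤ q) σ≤hi)

  private
    mate′ : Pt n → Pt n
    mate′ i = fromℕ< (σ<N (toℕ<n i))

    toℕ-mate′ : ∀ i → toℕ (mate′ i) ≡ σ (toℕ i)
    toℕ-mate′ i = toℕ-fromℕ< _

  opaque
    matching : Matching n
    matching = linearMatching mate′
      (λ i → toℕ-injective (trans (toℕ-mate′ (mate′ i)) (trans (cong σ (toℕ-mate′ i)) (σσ (toℕ<n i)))))
      (λ i e → σ≢ (toℕ<n i) (trans (sym (toℕ-mate′ i)) (cong toℕ e)))
      (λ i j p q → let a , b = σ-nested (toℕ<n i) (toℕ<n j) p (subst (toℕ j <_) (toℕ-mate′ i) q) in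
         subst (toℕ i <_) (sym (toℕ-mate′ j)) a , subst₂ _<_ (sym (toℕ-mate′ j)) (sym (toℕ-mate′ i)) b)

    toℕ-mate : ∀ i → toℕ (Matching.mate matching i) ≡ σ (toℕ i)
    toℕ-mate = toℕ-mate′

  open Matching matching
  open Circle n
  open Geometry matching
  open Decode matching

  -- The outer edge `g` of the block runs from `a` to `b` and is short. Points strictly between lie
  -- inside its arc, and `b` is the mate of a start, so a visible start can only be `a`.
  vis⇒lo : ∀ {s} → Vis s → lo (toℕ s) ≡ toℕ s
  vis⇒lo {s} (st , vs) = lo≡s
    where
    x a b : ℕ
    x = toℕ s
    a = lo x
    b = hi x
    x<N : x < 2 * n
    x<N = toℕ<n s
    a<N : a < 2 * n
    a<N = ≤-<-trans (lo≤ x<N) x<N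
    g : Pt n
    g = fromℕ< a<N
    eg : toℕ g ≡ a
    eg = toℕ-fromℕ< a<N
    emg : toℕ (mate g) ≡ b
    emg = trans (toℕ-mate g) (trans (cong σ eg) (+-cancelʳ-≡ a _ _
      (trans (σ-sum-block x<N a<N ≤-refl (≤-trans (lo≤ x<N) (≤hi x<N))) (trans (σ-sum x<N) (+-comm a b)))))
    Dg : ∀ {y} → a ≤ toℕ y → a + D g y ≡ toℕ y
    Dg {y} le with D-steps g y
    ... | inj₁ (_ , e) = trans (cong (_+ D g y) (sym eg)) e
    ... | inj₂ (lt , _) = ⊥-elim (<⇒≱ (subst (toℕ y <_) eg lt) le)
    a≤b : a ≤ b
    a≤b = ≤-trans (lo≤ x<N) (≤hi x<N)
    aℓ : a + ℓ g ≡ b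
    aℓ = trans (Dg (subst (a ≤_) (sym emg) a≤b)) emg
    stg : Start g
    stg = +-cancelˡ-< a _ _ (subst (_< a + n) (sym aℓ) (short x<N))
    lo≡s : a ≡ x
    lo≡s with <-cmp a x | <-cmp x b
    ... | tri≈ _ e _ | _ = e
    ... | tri> _ _ gt | _ = ⊥-elim (<⇒≱ gt (lo≤ x<N))
    ... | tri< _ _ _ | tri> _ _ gt = ⊥-elim (<⇒≱ gt (≤hi x<N))
    ... | tri< _ _ _ | tri≈ _ e _ =
          ⊥-elim (start-mate stg (subst Start (toℕ-injective (trans e (sym emg))) st))
    ... | tri< lt _ _ | tri< lt′ _ _ = ⊥-elim (vs g stg
          ( +-cancelˡ-< a _ _ (subst₂ _<_ (sym (+-identityʳ a)) (sym (Dg (<⇒≤ lt))) lt)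
          , +-cancelˡ-< a _ _ (subst₂ _<_ (sym (Dg (<⇒≤ lt))) (sym aℓ) lt′)))

  -- Were the start the larger endpoint, it would be the lowest point of its block and yet lie above
  -- its mate.
  visible⇒lo : ∀ {i} → T (visible matching i) → lo (toℕ i) ≡ toℕ i
  visible⇒lo {i} v with visible⁻ v
  ... | _ , s , inj₁ refl , vs = vis⇒lo vs
  ... | r , s , inj₂ refl , vs = ⊥-elim (<⇒≱ (<ᵇ⇒< _ _ r)
        (subst (_≤ toℕ i) (trans (sym e) (vis⇒lo vs)) (lo≤ (toℕ<n i))))
    where
    e : lo (toℕ (mate i)) ≡ lo (toℕ i)
    e = trans (cong lo (toℕ-mate i)) (proj₁ (block (toℕ<n i) (lo≤σ (toℕ<n i)) (σ≤hi (toℕ<n i))))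

-- Block matchings attaining the two bounds.

pick : ∀ {A : Set} → ℕ → ℕ → A → A → A
pick x c a b = if x <ᵇ c then a else b

pick-< : ∀ {A : Set} {x c} {a b : A} → x < c → pick x c a b ≡ a
pick-< {x = x} {c} lt with x <ᵇ c | <⇒<ᵇ lt
... | true | _ = refl

pick-≥ : ∀ {A : Set} {x c} {a b : A} → c ≤ x → pick x c a b ≡ b
pick-≥ {x = x} {c} ge with x <ᵇ c | <ᵇ⇒< x c
... | false | _ = refl
... | true  | f = ⊥-elim (<⇒≱ (f tt) ge)

n+m<2n : ∀ m → suc m + m < 2 * suc m
n+m<2n m = +-monoʳ-< (suc m) (s≤s (m≤m+n m 0))

even-pred⇒odd : ∀ {m} → Even (suc m) → Odd m
even-pred⇒odd (suc j , e) = j , suc-injective (trans e (cong suc (+-suc j (j + 0))))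

module TwoBlocks (m : ℕ) (even : Even (suc m)) where

  private
    n j : ℕ
    n = suc m
    j = proj₁ (even-pred⇒odd even)

    m≡ : m ≡ 1 + 2 * j
    m≡ = proj₂ (even-pred⇒odd even)

    lo hi : ℕ → ℕ
    lo x = pick x n 0 n
    hi x = pick x n m (n + m)

    low : IsBlock n lo hi 0 m
    low = record
      { end< = m≤m+n n (n + 0) ; odd = even-pred⇒odd even ; short = ≤-refl
      ; const = λ _ le → pick-< (s≤s le) , pick-< (s≤s le) }

    high : IsBlock n lo hi n (n + m)
    high = record
      { end< = n+m<2n m ; odd = n + j , trans (cong (λ k → n + (n + k)) m≡) (arith n j)
      ; short = +-monoʳ-< n ≤-refl ; const = λ le _ → pick-≥ le , pick-≥ le }
      where
      arith : ∀ n j → n + (n + (1 + 2 * j)) ≡ 1 + 2 * (n + j)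
      arith = solve-∀

    <2n⇒≤n+m : ∀ {x} → x < 2 * n → x ≤ n + m
    <2n⇒≤n+m {x} lt = s≤s⁻¹ (subst (x <_) (arith m) lt)
      where
      arith : ∀ m → 2 * suc m ≡ suc (suc m + m)
      arith = solve-∀

    blocks : Blocks n
    blocks = record { lo = lo ; hi = hi ; locate = locate }
      where
      locate : ∀ {x} → x < 2 * n → ∃₂ λ a b → a ≤ x × x ≤ b × IsBlock n lo hi a b
      locate {x} lt with x <? n
      ... | yes p = 0 , m , z≤n , s≤s⁻¹ p , low
      ... | no ¬p = n , n + m , ≮⇒≥ ¬p , <2n⇒≤n+m lt , high

    open BlockMatching blocks
    open Decode matching

    n<2n : n < 2 * n
    n<2n = m<m+n n (s≤s z≤n)

    first second : Pt n
    first = fromℕ< {0} (s≤s z≤n)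
    second = fromℕ< n<2n

    two : ∀ i → T (visible matching i) → i ≡ first ⊎ i ≡ second
    two i v with toℕ i <? n
    ... | yes p = inj₁ (toℕ-injective (trans (sym (visible⇒lo v)) (pick-< p)))
    ... | no ¬p = inj₂ (toℕ-injective (trans (sym (visible⇒lo v))
                    (trans (pick-≥ (≮⇒≥ ¬p)) (sym (toℕ-fromℕ< n<2n)))))

  visible≡2*flips-attained : ∃ λ (M : Matching n) → numVisible M ≡ 2 * numCenteredFlips M
  visible≡2*flips-attained = matching ,
    NoDiameter.visible≡2*flips (even⇒¬diam even) first second two

module ThreeBlocks (c : ℕ) (even : Even (6 + c)) where

  private
    n m j k : ℕ
    n = 6 + c
    m = 5 + c
    j = proj₁ (even-pred⇒odd even)
    k = proj₁ even

    m≡ : m ≡ 1 + 2 * j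
    m≡ = proj₂ (even-pred⇒odd even)

    -- The blocks are the index ranges from 0 to 3, from 4 to `n + 1`, and from `n + 2` to `2n - 1`.
    lo hi : ℕ → ℕ
    lo x = pick x 4 0 (pick x (2 + n) 4 (2 + n))
    hi x = pick x 4 3 (pick x (2 + n) (1 + n) (n + m))

    block₁ : IsBlock n lo hi 0 3
    block₁ = record
      { end< = s≤s (s≤s (s≤s (s≤s z≤n))) ; odd = 1 , refl ; short = s≤s (s≤s (s≤s (s≤s z≤n)))
      ; const = λ _ le → pick-< (s≤s le) , pick-< (s≤s le) }

    block₂ : IsBlock n lo hi 4 (1 + n)
    block₂ = record
      { end< = ≤-trans (≤-trans (n≤1+n _) (n≤1+n _))
          (subst (_≤ 2 * n) (+-comm n 4) (+-monoʳ-≤ n (s≤s (s≤s (s≤s (s≤s z≤n))))))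
      ; odd = 2 + k , trans (cong (5 +_) (proj₂ even)) (arith k)
      ; short = s≤s (s≤s (≤-trans (n≤1+n _) (n≤1+n _)))
      ; const = λ ge le → trans (pick-≥ ge) (pick-< (s≤s le)) , trans (pick-≥ ge) (pick-< (s≤s le)) }
      where
      arith : ∀ k → 5 + 2 * k ≡ 1 + 2 * (2 + k)
      arith = solve-∀

    block₃ : IsBlock n lo hi (2 + n) (n + m)
    block₃ = record
      { end< = n+m<2n m ; odd = 1 + n + j , trans (cong (λ z → 2 + n + (n + z)) m≡) (arith n j)
      ; short = ≤-trans (+-monoʳ-< n (n<1+n m)) (≤-trans (n≤1+n _) (n≤1+n _))
      ; const = λ ge _ → trans (pick-≥ (4≤ ge)) (pick-≥ ge) , trans (pick-≥ (4≤ ge)) (pick-≥ ge) }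
      where
      4≤ : ∀ {y} → 2 + n ≤ y → 4 ≤ y
      4≤ = ≤-trans (s≤s (s≤s (s≤s (s≤s z≤n))))
      arith : ∀ n j → 2 + n + (n + (1 + 2 * j)) ≡ 1 + 2 * (1 + n + j)
      arith = solve-∀

    locate : ∀ {x} → x < 2 * n → ∃₂ λ a b → a ≤ x × x ≤ b × IsBlock n lo hi a b
    locate {x} lt with x <? 4 | x <? 2 + n
    ... | yes p | _     = 0 , 3 , z≤n , s≤s⁻¹ p , block₁
    ... | no ¬p | yes q = 4 , 1 + n , ≮⇒≥ ¬p , s≤s⁻¹ q , block₂
    ... | no _  | no ¬q = 2 + n , n + m , ≮⇒≥ ¬q , s≤s⁻¹ (subst (x <_) (arith c) lt) , block₃
      where
      arith : ∀ c → 2 * (6 + c) ≡ suc (6 + c + (5 + c))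
      arith = solve-∀

    blocks : Blocks n
    blocks = record { lo = lo ; hi = hi ; locate = locate }

    open BlockMatching blocks
    open Decode matching
    open Geometry matching
    open Circle n

    data BlockStart : ℕ → Set where
      start₁ : BlockStart 0
      start₂ : BlockStart 4
      start₃ : BlockStart (2 + n)

    lo-start : ∀ x → BlockStart (lo x)
    lo-start x with x <ᵇ 4 | x <ᵇ 2 + n
    ... | true  | _     = start₁
    ... | false | true  = start₂
    ... | false | false = start₃

    -- Among the starts 0, 4 and `n + 2` no difference is `n`; for 0 and 4 this rests on `n ≥ 6`.
    -- The absent clauses equate numerals whose constructors clash.
    ¬antipodal : ∀ {u v} → BlockStart u → BlockStart v → u + n ≢ v
    ¬antipodal start₁ start₃ e = m≢1+n+m n {1} e
    ¬antipodal start₂ start₃ e = m≢1+n+m (2 + n) {1} (sym e)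
    ¬antipodal start₃ start₃ e = m≢1+n+m (2 + n) {m} (sym (trans (+-comm n (2 + n)) e))

    far : ∀ {s t} → Vis s → Vis t → D s t ≢ n
    far {s} {t} vs vt e with subst BlockStart (vis⇒lo vs) (lo-start (toℕ s))
                           | subst BlockStart (vis⇒lo vt) (lo-start (toℕ t)) | D-steps s t
    ... | bs | bt | inj₁ (_ , f) = ¬antipodal bs bt (trans (cong (toℕ s +_) (sym e)) f)
    -- In the wrapping case `s + n = 2n + t` becomes `t + n = s`, so the two starts change roles.
    ... | bs | bt | inj₂ (_ , f) = ¬antipodal bt bs (+-cancelˡ-≡ n _ _
          (trans (arith n (toℕ t)) (trans (sym f) (trans (cong (toℕ s +_) e) (+-comm (toℕ s) n)))))
      where
      arith : ∀ n t → n + (t + n) ≡ 2 * n + t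
      arith = solve-∀

  flips≡visible-attained : ∃ λ (M : Matching n) → numCenteredFlips M ≡ numVisible M
  flips≡visible-attained = matching , NoDiameter.flips≡visible (even⇒¬diam even) far

theorem3 : (n : ℕ) → 2 ≤ n →
    (Odd n → (M : Matching n) → numCenteredFlips M ≡ numVisible M) ×
    (Even n →
    ((M : Matching n) →
    (numCenteredFlips M ≤ numVisible M) × (numVisible M ≤ 2 * numCenteredFlips M)) ×
    (6 ≤ n → ∃ λ (M : Matching n) → numCenteredFlips M ≡ numVisible M) ×
    (∃ λ (M : Matching n) → numVisible M ≡ 2 * numCenteredFlips M))
theorem3 n 2≤n =
  (λ odd M → Decode.odd⇒flips≡visible M odd) ,
  λ even → bounds even , upper n even , lower n 2≤n even
  where
  bounds : Even n → (M : Matching n) →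
           (numCenteredFlips M ≤ numVisible M) × (numVisible M ≤ 2 * numCenteredFlips M)
  bounds even M = flips≤visible , visible≤2*flips
    where
    open Decode M
    open NoDiameter (even⇒¬diam even)

  upper : ∀ n → Even n → 6 ≤ n → ∃ λ (M : Matching n) → numCenteredFlips M ≡ numVisible M
  upper n even 6≤n with m≤n⇒∃[o]m+o≡n 6≤n
  ... | c , refl = ThreeBlocks.flips≡visible-attained c even

  lower : ∀ n → 2 ≤ n → Even n → ∃ λ (M : Matching n) → numVisible M ≡ 2 * numCenteredFlips M
  lower (suc m) _ even = TwoBlocks.visible≡2*flips-attained m even
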